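{- For every integer $r\geq 0$, $$t(\underbrace{2,2,\ldots,2}_{r},3)=\sum_{k=1}^{r+1}(-1)^{k+1}\,d_{r,0}^k\,\frac{1}{2^{2k}}\,\zeta(2k+1)\,t(\underbrace{2,2,\ldots,2}_{r+1-k}),$$ where $d_{r,0}^k=\binom{2k}{2r+1}+\left(1-\frac{1}{2^{2k}}\right)2k$.
   Context: For positive integers $k_1,\ldots,k_m$ with $k_m>1$, the multiple $t$-value is $t(k_1,\ldots,k_m)=\sum_{1\leq n_1<n_2<\cdots<n_m}\frac{1}{(2n_1-1)^{k_1}\cdots(2n_m-1)^{k_m}}$; the empty $t$-value ($m=0$) is $1$. $\zeta$ is the Riemann zeta function. Binomial coefficients $\binom{a}{b}$ with $b>a$ are $0$. -}

module Defs where

open import Data.Integer.Base as ℤ using (+_; -1ℤ)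
import Data.Integer.Properties as ℤ
open import Data.List.Base using (List; []; _∷_; foldl; replicate; _∷ʳ_)
open import Data.List.Properties using (foldl-∷ʳ)
open import Data.List.Relation.Unary.All using (All; []; _∷_)
import Data.List.Relation.Unary.All.Properties as All
open import Data.Nat.Base as ℕ using (ℕ; zero; suc; NonZero; z≤n; s≤s)
import Data.Nat.Properties as ℕ
open import Data.Nat.Combinatorics using (_C_)
import Data.Nat.Solver as ℕSolver
open import Data.Product.Base using (∃; _×_; _,_)
open import Data.Rational.Base as ℚ
  using (ℚ; 0ℚ; 1ℚ; ½; _/_; _+_; _*_; _-_; -_; _≤_; _<_; _>_; ∣_∣; mkℚ; toℚᵘ; Positive)
open import Data.Rational.Properties
import Data.Rational.Solver as ℚSolver
open import Data.Rational.Unnormalised.Base as ℚᵘ using (mkℚᵘ; *≤*)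
import Data.Rational.Unnormalised.Properties as ℚᵘ
open import Data.Sum.Base using (inj₁; inj₂)
open import Function.Base using (case_of_)
open import Relation.Binary.PropositionalEquality
  using (_≡_; refl; sym; trans; cong; cong₂; subst)

-- Real numbers as Cauchy sequences of rationals; _≃_ (the difference tends
-- to 0) is the equality of reals.

Cauchy : (ℕ → ℚ) → Set
Cauchy x = ∀ ε → ε > 0ℚ → ∃ λ N → ∀ m n → N ℕ.≤ m → N ℕ.≤ n → ∣ x m - x n ∣ ≤ ε

record ℝ : Set where
  constructor mkℝ
  field
    seq    : ℕ → ℚ
    cauchy : Cauchy seq

open ℝ public

infix 4 _≃_

_≃_ : ℝ → ℝ → Set
x ≃ y = ∀ ε → ε > 0ℚ → ∃ λ N → ∀ n → N ℕ.≤ n → ∣ seq x n - seq y n ∣ ≤ ε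

half>0 : ∀ {ε} → ε > 0ℚ → ε * ½ > 0ℚ
half>0 {ε} ε>0 =
  positive⁻¹ (ε * ½) {{pos*pos⇒pos ε {{ℚ.positive ε>0}} ½}}

half+half : ∀ ε → ε * ½ + ε * ½ ≡ ε
half+half ε = trans (sym (*-distribˡ-+ ε ½ ½)) (*-identityʳ ε)

-- p ≤ q whenever q is p plus something non-negative.
≤-from : ∀ {p q} d → 0ℚ ≤ d → p + d ≡ q → p ≤ q
≤-from {p} d 0≤d refl = subst (_≤ p + d) (+-identityʳ p) (+-monoʳ-≤ p 0≤d)

*-nonNeg : ∀ {p q} → 0ℚ ≤ p → 0ℚ ≤ q → 0ℚ ≤ p * q
*-nonNeg {p} {q} 0≤p 0≤q = nonNegative⁻¹ (p * q)
  {{nonNeg*nonNeg⇒nonNeg p {{ℚ.nonNegative 0≤p}} q {{ℚ.nonNegative 0≤q}}}}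

+-nonNeg : ∀ {p q} → 0ℚ ≤ p → 0ℚ ≤ q → 0ℚ ≤ p + q
+-nonNeg = +-mono-≤

*-mono : ∀ {p q r s} → 0ℚ ≤ p → 0ℚ ≤ s → p ≤ q → r ≤ s → p * r ≤ q * s
*-mono {p} {q} {r} {s} 0≤p 0≤s p≤q r≤s = ≤-trans
  (*-monoˡ-≤-nonNeg p {{ℚ.nonNegative 0≤p}} r≤s)
  (*-monoʳ-≤-nonNeg s {{ℚ.nonNegative 0≤s}} p≤q)

cauchy-const : ∀ q → Cauchy (λ _ → q)
cauchy-const q ε ε>0 = 0 , λ _ _ _ _ →
  subst (_≤ ε) (sym (cong ∣_∣ (+-inverseʳ q))) (<⇒≤ ε>0)

cauchy-+ : ∀ {x y} → Cauchy x → Cauchy y → Cauchy (λ n → x n + y n)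
cauchy-+ {x} {y} cx cy ε ε>0 with cx (ε * ½) (half>0 ε>0) | cy (ε * ½) (half>0 ε>0)
... | M , hM | N , hN = M ℕ.+ N , λ m n m≥ n≥ → begin
    ∣ (x m + y m) - (x n + y n) ∣        ≡⟨ cong ∣_∣ (rearrange (x m) (y m) (x n) (y n)) ⟩
    ∣ (x m - x n) + (y m - y n) ∣        ≤⟨ ∣p+q∣≤∣p∣+∣q∣ (x m - x n) (y m - y n) ⟩
    ∣ x m - x n ∣ + ∣ y m - y n ∣        ≤⟨ +-mono-≤
      (hM m n (ℕ.≤-trans (ℕ.m≤m+n M N) m≥) (ℕ.≤-trans (ℕ.m≤m+n M N) n≥))
      (hN m n (ℕ.≤-trans (ℕ.m≤n+m N M) m≥) (ℕ.≤-trans (ℕ.m≤n+m N M) n≥)) ⟩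
    ε * ½ + ε * ½                        ≡⟨ half+half ε ⟩
    ε                                    ∎
  where
  open ≤-Reasoning
  open ℚSolver.+-*-Solver
  rearrange : ∀ a b c d → (a + b) - (c + d) ≡ (a - c) + (b - d)
  rearrange = solve 4 (λ a b c d → (a :+ b) :- (c :+ d) := (a :- c) :+ (b :- d)) refl

eventually-bounded : ∀ {x} → Cauchy x →
  ∃ λ B → B > 0ℚ × ∃ λ N → ∀ n → N ℕ.≤ n → ∣ x n ∣ ≤ B
eventually-bounded {x} cx with cx 1ℚ (positive⁻¹ 1ℚ)
... | N , h = ∣ x N ∣ + 1ℚ
            , +-mono-≤-< (0≤∣p∣ (x N)) (positive⁻¹ 1ℚ)
            , N , λ n n≥ → begin
    ∣ x n ∣                    ≡⟨ cong ∣_∣ (split (x n) (x N)) ⟩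
    ∣ x N + (x n - x N) ∣      ≤⟨ ∣p+q∣≤∣p∣+∣q∣ (x N) (x n - x N) ⟩
    ∣ x N ∣ + ∣ x n - x N ∣    ≤⟨ +-monoʳ-≤ ∣ x N ∣ (h n N n≥ ℕ.≤-refl) ⟩
    ∣ x N ∣ + 1ℚ               ∎
  where
  open ≤-Reasoning
  open ℚSolver.+-*-Solver
  split : ∀ a b → a ≡ b + (a - b)
  split = solve 2 (λ a b → a := b :+ (a :- b)) refl

-- For c > 0, every ε > 0 has the form c * δ with δ > 0.
divide : ∀ {c ε} → c > 0ℚ → ε > 0ℚ → ∃ λ δ → δ > 0ℚ × c * δ ≡ ε
divide {c} {ε} c>0 ε>0 = ε * c⁻¹ , δ>0 , eq
  where
  instance
    c⁺ : Positive c
    c⁺ = ℚ.positive c>0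
    c≢0 : ℚ.NonZero c
    c≢0 = pos⇒nonZero c
  c⁻¹ = ℚ.1/ c
  δ>0 : ε * c⁻¹ > 0ℚ
  δ>0 = positive⁻¹ (ε * c⁻¹) {{pos*pos⇒pos ε {{ℚ.positive ε>0}} c⁻¹ {{1/pos⇒pos c}}}}
  eq : c * (ε * c⁻¹) ≡ ε
  eq = trans (*-comm c (ε * c⁻¹)) (trans (*-assoc ε c⁻¹ c)
         (trans (cong (ε *_) (*-inverseˡ c)) (*-identityʳ ε)))

module _ {x y : ℕ → ℚ} {B C δ ε : ℚ} {K L M N : ℕ} (δ>0 : δ > 0ℚ)
  (Bδ+Cδ≡ε : (B + C) * δ ≡ ε)
  (hB : ∀ n → K ℕ.≤ n → ∣ x n ∣ ≤ B)
  (hC : ∀ n → L ℕ.≤ n → ∣ y n ∣ ≤ C)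
  (hM : ∀ m n → M ℕ.≤ m → M ℕ.≤ n → ∣ x m - x n ∣ ≤ δ)
  (hN : ∀ m n → N ℕ.≤ m → N ℕ.≤ n → ∣ y m - y n ∣ ≤ δ)
  where

  product-close : ∀ m n → (K ℕ.+ L) ℕ.+ (M ℕ.+ N) ℕ.≤ m → (K ℕ.+ L) ℕ.+ (M ℕ.+ N) ℕ.≤ n →
    ∣ x m * y m - x n * y n ∣ ≤ ε
  product-close m n m≥ n≥ = begin
      ∣ x m * y m - x n * y n ∣                              ≡⟨ cong ∣_∣ (rearrange (x m) (y m) (x n) (y n)) ⟩
      ∣ x m * (y m - y n) + y n * (x m - x n) ∣              ≤⟨ ∣p+q∣≤∣p∣+∣q∣ (x m * (y m - y n)) (y n * (x m - x n)) ⟩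
      ∣ x m * (y m - y n) ∣ + ∣ y n * (x m - x n) ∣          ≡⟨ cong₂ _+_ (∣p*q∣≡∣p∣*∣q∣ (x m) (y m - y n)) (∣p*q∣≡∣p∣*∣q∣ (y n) (x m - x n)) ⟩
      ∣ x m ∣ * ∣ y m - y n ∣ + ∣ y n ∣ * ∣ x m - x n ∣      ≤⟨ +-mono-≤
        (*-mono (0≤∣p∣ (x m)) (<⇒≤ δ>0) (hB m (K≤ m≥)) (hN m n (N≤ m≥) (N≤ n≥)))
        (*-mono (0≤∣p∣ (y n)) (<⇒≤ δ>0) (hC n (L≤ n≥)) (hM m n (M≤ m≥) (M≤ n≥))) ⟩
      B * δ + C * δ                                          ≡⟨ sym (*-distribʳ-+ δ B C) ⟩
      (B + C) * δ                                            ≡⟨ Bδ+Cδ≡ε ⟩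
      ε                                                      ∎
    where
    open ≤-Reasoning
    open ℚSolver.+-*-Solver
    rearrange : ∀ a b c d → a * b - c * d ≡ a * (b - d) + d * (a - c)
    rearrange = solve 4 (λ a b c d → a :* b :- c :* d := a :* (b :- d) :+ d :* (a :- c)) refl
    KL≤ : ∀ {m} → (K ℕ.+ L) ℕ.+ (M ℕ.+ N) ℕ.≤ m → K ℕ.+ L ℕ.≤ m
    KL≤ = ℕ.≤-trans (ℕ.m≤m+n (K ℕ.+ L) (M ℕ.+ N))
    MN≤ : ∀ {m} → (K ℕ.+ L) ℕ.+ (M ℕ.+ N) ℕ.≤ m → M ℕ.+ N ℕ.≤ m
    MN≤ = ℕ.≤-trans (ℕ.m≤n+m (M ℕ.+ N) (K ℕ.+ L))
    K≤ : ∀ {m} → (K ℕ.+ L) ℕ.+ (M ℕ.+ N) ℕ.≤ m → K ℕ.≤ m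
    K≤ h = ℕ.≤-trans (ℕ.m≤m+n K L) (KL≤ h)
    L≤ : ∀ {m} → (K ℕ.+ L) ℕ.+ (M ℕ.+ N) ℕ.≤ m → L ℕ.≤ m
    L≤ h = ℕ.≤-trans (ℕ.m≤n+m L K) (KL≤ h)
    M≤ : ∀ {m} → (K ℕ.+ L) ℕ.+ (M ℕ.+ N) ℕ.≤ m → M ℕ.≤ m
    M≤ h = ℕ.≤-trans (ℕ.m≤m+n M N) (MN≤ h)
    N≤ : ∀ {m} → (K ℕ.+ L) ℕ.+ (M ℕ.+ N) ℕ.≤ m → N ℕ.≤ m
    N≤ h = ℕ.≤-trans (ℕ.m≤n+m N M) (MN≤ h)

cauchy-* : ∀ {x y} → Cauchy x → Cauchy y → Cauchy (λ n → x n * y n)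
cauchy-* {x} {y} cx cy ε ε>0 =
  let B , B>0 , K , hB = eventually-bounded {x} cx
      C , C>0 , L , hC = eventually-bounded {y} cy
      δ , δ>0 , eq     = divide (+-mono-< B>0 C>0) ε>0
      M , hM           = cx δ δ>0
      N , hN           = cy δ δ>0
  in (K ℕ.+ L) ℕ.+ (M ℕ.+ N) , product-close {x} {y} δ>0 eq hB hC hM hN

fromℚ : ℚ → ℝ
fromℚ q = mkℝ (λ _ → q) (cauchy-const q)

infixl 6 _+ᴿ_
infixl 7 _*ᴿ_

_+ᴿ_ : ℝ → ℝ → ℝ
x +ᴿ y = mkℝ (λ n → seq x n + seq y n) (cauchy-+ {seq x} {seq y} (cauchy x) (cauchy y))

_*ᴿ_ : ℝ → ℝ → ℝ
x *ᴿ y = mkℝ (λ n → seq x n * seq y n) (cauchy-* {seq x} {seq y} (cauchy x) (cauchy y))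

sumFrom1 : {A : Set} → (A → A → A) → A → (n : ℕ) → ((k : ℕ) → .{{NonZero k}} → A) → A
sumFrom1 _⊕_ 0# zero    f = 0#
sumFrom1 _⊕_ 0# (suc n) f = sumFrom1 _⊕_ 0# n f ⊕ f (suc n)

∑ : (n : ℕ) → ((k : ℕ) → .{{NonZero k}} → ℚ) → ℚ
∑ = sumFrom1 _+_ 0ℚ

∑ᴿ : (n : ℕ) → ((k : ℕ) → .{{NonZero k}} → ℝ) → ℝ
∑ᴿ = sumFrom1 _+ᴿ_ (fromℚ 0ℚ)

1/_^_ : (n k : ℕ) → .{{NonZero n}} → ℚ
1/ n ^ k = (+ 1 / (n ℕ.^ k)) {{ℕ.m^n≢0 n k}}

-- The truncated subtraction is exact, as n ranges over n ≥ 1.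
odd : ℕ → ℕ
odd n = 2 ℕ.* n ℕ.∸ 1

odd-suc : ∀ n → odd (suc n) ≡ suc (2 ℕ.* n)
odd-suc n = ℕ.+-suc n (n ℕ.+ 0)

odd-nonZero : ∀ n → .{{NonZero n}} → NonZero (odd n)
odd-nonZero (suc n) = subst NonZero (sym (odd-suc n)) _

1/[2_-1]^_ : (n k : ℕ) → .{{NonZero n}} → ℚ
1/[2 n -1]^ k = (1/ odd n ^ k) {{odd-nonZero n}}

ζSum : (s N : ℕ) → ℚ
ζSum s N = ∑ N λ n → 1/ n ^ s

-- If S N is the sum for k₁,…,kₘ₋₁ restricted to nₘ₋₁ ≤ N, then tStep S kₘ N
-- is the sum for k₁,…,kₘ restricted to nₘ ≤ N; the bound nₘ₋₁ < nₘ appears as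
-- nₘ₋₁ ≤ nₘ - 1.  The empty product contributes 1, whence the initial value.
tStep : (S : ℕ → ℚ) (k N : ℕ) → ℚ
tStep S k N = ∑ N λ n → S (n ℕ.∸ 1) * 1/[2 n -1]^ k

tSum : List ℕ → ℕ → ℚ
tSum = foldl tStep (λ _ → 1ℚ)

frac : ∀ a b → .{{_ : NonZero b}} → toℚᵘ (+ a / b) ℚᵘ.≃ (+ a ℚᵘ./ b)
frac a (suc b) = toℚᵘ-fromℚᵘ (mkℚᵘ (+ a) b)

frac≤ : ∀ a b c d → .{{_ : NonZero b}} → .{{_ : NonZero d}} →
  a ℕ.* d ℕ.≤ c ℕ.* b → + a / b ≤ + c / d
frac≤ a b@(suc _) c d@(suc _) h = toℚᵘ-cancel-≤ (begin
    toℚᵘ (+ a / b)   ≃⟨ frac a b ⟩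
    + a ℚᵘ./ b       ≤⟨ *≤* (ℤ-≤ h) ⟩
    + c ℚᵘ./ d       ≃⟨ ℚᵘ.≃-sym (frac c d) ⟩
    toℚᵘ (+ c / d)   ∎)
  where
  open ℚᵘ.≤-Reasoning
  ℤ-≤ : a ℕ.* d ℕ.≤ c ℕ.* b → + a ℤ.* + d ℤ.≤ + c ℤ.* + b
  ℤ-≤ h rewrite sym (ℤ.pos-* a d) | sym (ℤ.pos-* c b) = ℤ.+≤+ h

frac+ : ∀ a b c d → .{{_ : NonZero b}} → .{{_ : NonZero d}} →
  + a / b + + c / d ≡ (+ (a ℕ.* d ℕ.+ c ℕ.* b) / (b ℕ.* d)) {{ℕ.m*n≢0 b d}}
frac+ a b@(suc _) c d@(suc _) = toℚᵘ-injective (begin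
    toℚᵘ (+ a / b + + c / d)                    ≈⟨ toℚᵘ-homo-+ (+ a / b) (+ c / d) ⟩
    toℚᵘ (+ a / b) ℚᵘ.+ toℚᵘ (+ c / d)          ≈⟨ ℚᵘ.+-cong (frac a b) (frac c d) ⟩
    (+ a ℚᵘ./ b) ℚᵘ.+ (+ c ℚᵘ./ d)              ≡⟨ cong (λ z → z ℚᵘ./ (b ℕ.* d)) eq ⟩
    + (a ℕ.* d ℕ.+ c ℕ.* b) ℚᵘ./ (b ℕ.* d)      ≈⟨ ℚᵘ.≃-sym (frac (a ℕ.* d ℕ.+ c ℕ.* b) (b ℕ.* d)) ⟩
    toℚᵘ (+ (a ℕ.* d ℕ.+ c ℕ.* b) / (b ℕ.* d))  ∎)
  where
  open ℚᵘ.≃-Reasoning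
  eq : + a ℤ.* + d ℤ.+ + c ℤ.* + b ≡ + (a ℕ.* d ℕ.+ c ℕ.* b)
  eq = cong₂ ℤ._+_ (sym (ℤ.pos-* a d)) (sym (ℤ.pos-* c b))

frac* : ∀ a b c d → .{{_ : NonZero b}} → .{{_ : NonZero d}} →
  + a / b * (+ c / d) ≡ (+ (a ℕ.* c) / (b ℕ.* d)) {{ℕ.m*n≢0 b d}}
frac* a b@(suc _) c d@(suc _) = toℚᵘ-injective (begin
    toℚᵘ (+ a / b * (+ c / d))            ≈⟨ toℚᵘ-homo-* (+ a / b) (+ c / d) ⟩
    toℚᵘ (+ a / b) ℚᵘ.* toℚᵘ (+ c / d)    ≈⟨ ℚᵘ.*-cong (frac a b) (frac c d) ⟩
    (+ a ℚᵘ./ b) ℚᵘ.* (+ c ℚᵘ./ d)        ≡⟨ cong (λ z → z ℚᵘ./ (b ℕ.* d)) (sym (ℤ.pos-* a c)) ⟩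
    + (a ℕ.* c) ℚᵘ./ (b ℕ.* d)            ≈⟨ ℚᵘ.≃-sym (frac (a ℕ.* c) (b ℕ.* d)) ⟩
    toℚᵘ (+ (a ℕ.* c) / (b ℕ.* d))        ∎)
  where open ℚᵘ.≃-Reasoning

frac≥0 : ∀ a b → .{{_ : NonZero b}} → 0ℚ ≤ + a / b
frac≥0 a b = nonNegative⁻¹ (+ a / b) {{normalize-nonNeg a b}}

-- Only used for non-negative u, where it says that u tends to 0.
Null : (ℕ → ℚ) → Set
Null u = ∀ ε → ε > 0ℚ → ∃ λ N → ∀ n → N ℕ.≤ n → u n ≤ ε

null-+ : ∀ {u v} → Null u → Null v → Null (λ n → u n + v n)
null-+ nu nv ε ε>0 with nu (ε * ½) (half>0 ε>0) | nv (ε * ½) (half>0 ε>0)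
... | M , hM | N , hN = M ℕ.+ N , λ n n≥ → ≤-trans
  (+-mono-≤ (hM n (ℕ.≤-trans (ℕ.m≤m+n M N) n≥)) (hN n (ℕ.≤-trans (ℕ.m≤n+m N M) n≥)))
  (≤-reflexive (half+half ε))

null-scale : ∀ {u} c → 0ℚ ≤ c → (∀ n → 0ℚ ≤ u n) → Null u → Null (λ n → c * u n)
null-scale {u} c 0≤c 0≤u nu ε ε>0 with divide (+-mono-≤-< 0≤c (positive⁻¹ 1ℚ)) ε>0
... | δ , δ>0 , eq with nu δ δ>0
... | N , h = N , λ n n≥ → ≤-trans
  (*-mono 0≤c (<⇒≤ δ>0) (≤-from 1ℚ (nonNegative⁻¹ 1ℚ) refl) (h n n≥))
  (≤-reflexive eq)

-- The telescoping weights w n = g n - g (n+1) = 2/((n+1)(n+2)).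
g w : ℕ → ℚ
g n = + 2 / suc n
w n = g n - g (suc n)

g≥0 : ∀ n → 0ℚ ≤ g n
g≥0 n = frac≥0 2 (suc n)

null-g : Null g
null-g ε@(mkℚ (+ suc p) d _) ε>0 = 2 ℕ.* suc d , λ n n≥ →
  subst (g n ≤_) (↥p/↧p≡p ε) (frac≤ 2 (suc n) (suc p) (suc d) (begin
    2 ℕ.* suc d       ≤⟨ n≥ ⟩
    n                 ≤⟨ ℕ.n≤1+n n ⟩
    suc n             ≤⟨ ℕ.m≤n*m (suc n) (suc p) ⟩
    suc p ℕ.* suc n   ∎))
  where open ℕ.≤-Reasoning
null-g (mkℚ (+ 0) _ _) (ℚ.*<* (ℤ.+<+ ()))
null-g (mkℚ ℤ.-[1+ _ ] _ _) (ℚ.*<* ())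

+≤⇒≤- : ∀ {p q r} → p + q ≤ r → p ≤ r - q
+≤⇒≤- {p} {q} {r} h = subst (_≤ r - q) (lem p q) (+-monoˡ-≤ (- q) h)
  where
  open ℚSolver.+-*-Solver
  lem : ∀ a b → a + b - b ≡ a
  lem = solve 2 (λ a b → a :+ b :- b := a) refl

w-large : ∀ q n → .{{_ : NonZero q}} →
  suc n ℕ.* suc (suc n) ℕ.≤ 2 ℕ.* q → + 1 / q ≤ w n
w-large q n h = +≤⇒≤- (≤-trans (≤-reflexive (frac+ 1 q 2 (suc (suc n))))
  (frac≤ _ (q ℕ.* suc (suc n)) 2 (suc n) {{ℕ.m*n≢0 q (suc (suc n))}} (begin
    (1 ℕ.* suc (suc n) ℕ.+ 2 ℕ.* q) ℕ.* suc n             ≡⟨ lhs n q ⟩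
    suc n ℕ.* suc (suc n) ℕ.+ 2 ℕ.* q ℕ.* suc n           ≤⟨ ℕ.+-monoˡ-≤ _ h ⟩
    2 ℕ.* q ℕ.+ 2 ℕ.* q ℕ.* suc n                         ≡⟨ rhs n q ⟩
    2 ℕ.* (q ℕ.* suc (suc n))                             ∎)))
  where
  open ℕ.≤-Reasoning
  open ℕSolver.+-*-Solver
  lhs : ∀ n q → (1 ℕ.* suc (suc n) ℕ.+ 2 ℕ.* q) ℕ.* suc n
              ≡ suc n ℕ.* suc (suc n) ℕ.+ 2 ℕ.* q ℕ.* suc n
  lhs = solve 2 (λ n q →
    (con 1 :* (con 2 :+ n) :+ con 2 :* q) :* (con 1 :+ n)
    := (con 1 :+ n) :* (con 2 :+ n) :+ con 2 :* q :* (con 1 :+ n)) refl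
  rhs : ∀ n q → 2 ℕ.* q ℕ.+ 2 ℕ.* q ℕ.* suc n ≡ 2 ℕ.* (q ℕ.* suc (suc n))
  rhs = solve 2 (λ n q →
    con 2 :* q :+ con 2 :* q :* (con 1 :+ n) := con 2 :* (q :* (con 2 :+ n))) refl

w-harmonic : ∀ q n → .{{_ : NonZero q}} → suc n ℕ.≤ q → + 1 / q * g (suc n) ≤ w n
w-harmonic q n h = +≤⇒≤- (≤-trans
  (≤-reflexive (trans (cong (λ z → z + g (suc n)) (frac* 1 q 2 (suc (suc n))))
                      (frac+ 2 D 2 (suc (suc n)))))
  (frac≤ _ (D ℕ.* suc (suc n)) 2 (suc n) {{ℕ.m*n≢0 D (suc (suc n))}} (begin
    (2 ℕ.* suc (suc n) ℕ.+ 2 ℕ.* D) ℕ.* suc n                    ≡⟨ lhs n q ⟩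
    2 ℕ.* suc (suc n) ℕ.* suc n ℕ.+ 2 ℕ.* D ℕ.* suc n            ≤⟨ ℕ.+-monoˡ-≤ _ (ℕ.*-monoʳ-≤ (2 ℕ.* suc (suc n)) h) ⟩
    2 ℕ.* suc (suc n) ℕ.* q ℕ.+ 2 ℕ.* D ℕ.* suc n                ≡⟨ rhs n q ⟩
    2 ℕ.* (D ℕ.* suc (suc n))                                    ∎)))
  where
  D = q ℕ.* suc (suc n)
  instance
    D≢0 : NonZero D
    D≢0 = ℕ.m*n≢0 q (suc (suc n))
  open ℕ.≤-Reasoning
  open ℕSolver.+-*-Solver
  lhs : ∀ n q → (2 ℕ.* suc (suc n) ℕ.+ 2 ℕ.* (q ℕ.* suc (suc n))) ℕ.* suc n
              ≡ 2 ℕ.* suc (suc n) ℕ.* suc n ℕ.+ 2 ℕ.* (q ℕ.* suc (suc n)) ℕ.* suc n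
  lhs = solve 2 (λ n q →
    (con 2 :* (con 2 :+ n) :+ con 2 :* (q :* (con 2 :+ n))) :* (con 1 :+ n)
    := con 2 :* (con 2 :+ n) :* (con 1 :+ n) :+ con 2 :* (q :* (con 2 :+ n)) :* (con 1 :+ n)) refl
  rhs : ∀ n q → 2 ℕ.* suc (suc n) ℕ.* q ℕ.+ 2 ℕ.* (q ℕ.* suc (suc n)) ℕ.* suc n
              ≡ 2 ℕ.* ((q ℕ.* suc (suc n)) ℕ.* suc (suc n))
  rhs = solve 2 (λ n q →
    con 2 :* (con 2 :+ n) :* q :+ con 2 :* (q :* (con 2 :+ n)) :* (con 1 :+ n)
    := con 2 :* ((q :* (con 2 :+ n)) :* (con 2 :+ n))) refl

n≤n^k : ∀ n k → .{{_ : NonZero n}} → 1 ℕ.≤ k → n ℕ.≤ n ℕ.^ k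
n≤n^k n k h = subst (ℕ._≤ n ℕ.^ k) (ℕ.^-identityʳ n) (ℕ.^-monoʳ-≤ n h)

suc≤odd : ∀ n → suc n ℕ.≤ odd (suc n)
suc≤odd n = subst (suc n ℕ.≤_) (sym (odd-suc n)) (s≤s (ℕ.m≤m+n n (n ℕ.+ 0)))

square-large : ∀ n q k → .{{_ : NonZero q}} → suc n ℕ.≤ q → 1 ℕ.< k →
  suc n ℕ.* suc (suc n) ℕ.≤ 2 ℕ.* q ℕ.^ k
square-large n q k n<q 1<k = begin
    suc n ℕ.* suc (suc n)       ≤⟨ ℕ.*-monoʳ-≤ (suc n) (s≤s (ℕ.m≤n+m (suc n) n)) ⟩
    suc n ℕ.* (suc n ℕ.+ suc n) ≡⟨ eq n ⟩
    2 ℕ.* suc n ℕ.^ 2           ≤⟨ ℕ.*-monoʳ-≤ 2 (ℕ.^-monoˡ-≤ 2 n<q) ⟩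
    2 ℕ.* q ℕ.^ 2               ≤⟨ ℕ.*-monoʳ-≤ 2 (ℕ.^-monoʳ-≤ q 1<k) ⟩
    2 ℕ.* q ℕ.^ k               ∎
  where
  open ℕ.≤-Reasoning
  open ℕSolver.+-*-Solver
  eq : ∀ n → suc n ℕ.* (suc n ℕ.+ suc n) ≡ 2 ℕ.* suc n ℕ.^ 2
  eq = solve 1 (λ n → (con 1 :+ n) :* ((con 1 :+ n) :+ (con 1 :+ n))
                      := con 2 :* (con 1 :+ n) :^ 2) refl

module _ {P a U : ℕ → ℚ}
  (P-suc : ∀ n → P (suc n) ≡ P n + a n)
  (0≤a   : ∀ n → 0ℚ ≤ a n)
  (0≤U   : ∀ n → 0ℚ ≤ U n)
  (null  : Null U)
  (drop  : ∀ n → a n + U (suc n) ≤ U n)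
  where

  private
    open ℚSolver.+-*-Solver
    open ≤-Reasoning

    lower : ∀ j n → P n ≤ P (j ℕ.+ n)
    lower zero    n = ≤-refl
    lower (suc j) n = ≤-trans (lower j n)
      (≤-from (a (j ℕ.+ n)) (0≤a _) (sym (P-suc (j ℕ.+ n))))

    upper : ∀ j n → P (j ℕ.+ n) + U (j ℕ.+ n) ≤ P n + U n
    upper zero    n = ≤-refl
    upper (suc j) n = begin
      P (suc m) + U (suc m)       ≡⟨ cong (λ z → z + U (suc m)) (P-suc m) ⟩
      P m + a m + U (suc m)       ≡⟨ +-assoc (P m) (a m) (U (suc m)) ⟩
      P m + (a m + U (suc m))     ≤⟨ +-monoʳ-≤ (P m) (drop m) ⟩
      P m + U m                   ≤⟨ upper j n ⟩
      P n + U n                   ∎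
      where m = j ℕ.+ n

    close : ∀ {m n} → n ℕ.≤ m → ∣ P m - P n ∣ ≤ U n
    close {m} {n} n≤m with ℕ.m≤n⇒∃[o]m+o≡n n≤m
    ... | j , refl rewrite ℕ.+-comm n j = begin
      ∣ P (j ℕ.+ n) - P n ∣    ≡⟨ 0≤p⇒∣p∣≡p 0≤diff ⟩
      P (j ℕ.+ n) - P n        ≤⟨ +-monoˡ-≤ (- P n) (≤-trans {P (j ℕ.+ n)}
                                    (≤-from (U (j ℕ.+ n)) (0≤U (j ℕ.+ n)) refl) (upper j n)) ⟩
      P n + U n - P n          ≡⟨ solve 2 (λ p u → p :+ u :- p := u) refl (P n) (U n) ⟩
      U n                      ∎
      where
      0≤diff : 0ℚ ≤ P (j ℕ.+ n) - P n
      0≤diff = +≤⇒≤- (≤-trans (≤-reflexive (+-identityˡ (P n))) (lower j n))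

  telescope : Cauchy P
  telescope ε ε>0 with null ε ε>0
  ... | N , h = N , λ m n m≥ n≥ → case ℕ.≤-total n m of λ where
    (inj₁ n≤m) → ≤-trans (close n≤m) (h n n≥)
    (inj₂ m≤n) → ≤-trans (≤-reflexive (trans
      (cong ∣_∣ (solve 2 (λ x y → x :- y := :- (y :- x)) refl (P m) (P n)))
      (∣-p∣≡∣p∣ (P n - P m)))) (≤-trans (close m≤n) (h m m≥))

-- S n grows slowly enough that ∑ S n * w n converges, with tails bounded by U.
record Tame (S : ℕ → ℚ) : Set where
  field
    nonNeg : ∀ n → 0ℚ ≤ S n
    null   : Null (λ n → S n * g n)
    U      : ℕ → ℚ
    U≥0    : ∀ n → 0ℚ ≤ U n
    U-null : Null U
    U-drop : ∀ n → S n * w n + U (suc n) ≤ U n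

tame-1 : Tame (λ _ → 1ℚ)
tame-1 = record
  { nonNeg = λ _ → nonNegative⁻¹ 1ℚ
  ; null   = λ ε ε>0 → case null-g ε ε>0 of λ where
      (N , h) → N , λ n n≥ → ≤-trans (≤-reflexive (*-identityˡ (g n))) (h n n≥)
  ; U      = g
  ; U≥0    = g≥0
  ; U-null = null-g
  ; U-drop = λ n → ≤-reflexive
      (solve 2 (λ x y → con 1ℚ :* (x :- y) :+ y := x) refl (g n) (g (suc n)))
  }
  where open ℚSolver.+-*-Solver

module _ {S : ℕ → ℚ} (tame : Tame S) {k : ℕ} where
  open Tame tame

  private
    r : ℕ → ℚ
    r n = 1/[2 suc n -1]^ k

    oddᵏ≢0 : ∀ n → NonZero (odd (suc n) ℕ.^ k)
    oddᵏ≢0 n = ℕ.m^n≢0 (odd (suc n)) k {{odd-nonZero (suc n)}}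

    r≥0 : ∀ n → 0ℚ ≤ r n
    r≥0 n = frac≥0 1 (odd (suc n) ℕ.^ k) {{oddᵏ≢0 n}}

  tStep-cauchy : 1 ℕ.< k → Cauchy (tStep S k)
  tStep-cauchy 1<k = telescope {P = tStep S k} {a = λ n → S n * r n} (λ _ → refl)
    (λ n → *-nonNeg (nonNeg n) (r≥0 n)) U≥0 U-null
    (λ n → ≤-trans (+-monoˡ-≤ (U (suc n))
      (*-monoˡ-≤-nonNeg (S n) {{ℚ.nonNegative (nonNeg n)}} (r≤w n))) (U-drop n))
    where
    r≤w : ∀ n → r n ≤ w n
    r≤w n = w-large (odd (suc n) ℕ.^ k) n {{oddᵏ≢0 n}}
      (square-large n (odd (suc n)) k {{odd-nonZero (suc n)}} (suc≤odd n) 1<k)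

  module _ (1≤k : 1 ℕ.≤ k) where
    private
      open ≤-Reasoning
      open ℚSolver.+-*-Solver

      S⁺ : ℕ → ℚ
      S⁺ = tStep S k

      S⁺≥0 : ∀ n → 0ℚ ≤ S⁺ n
      S⁺≥0 zero    = ≤-refl
      S⁺≥0 (suc n) = +-nonNeg (S⁺≥0 n) (*-nonNeg (nonNeg n) (r≥0 n))

      n<oddᵏ : ∀ n → suc n ℕ.≤ odd (suc n) ℕ.^ k
      n<oddᵏ n = ℕ.≤-trans (suc≤odd n) (n≤n^k (odd (suc n)) k {{odd-nonZero (suc n)}} 1≤k)

      r≤g : ∀ n → r n ≤ g n
      r≤g n = frac≤ 1 (odd (suc n) ℕ.^ k) 2 (suc n) {{oddᵏ≢0 n}}
        (ℕ.*-mono-≤ {1} {2} (s≤s z≤n) (n<oddᵏ n))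

      rg≤w : ∀ n → r n * g (suc n) ≤ w n
      rg≤w n = w-harmonic (odd (suc n) ℕ.^ k) n {{oddᵏ≢0 n}} (n<oddᵏ n)

      growth : ∀ {ε N} → (∀ n → N ℕ.≤ n → S n * g n ≤ ε) → 0ℚ ≤ ε →
        ∀ j → S⁺ (j ℕ.+ N) ≤ S⁺ N + (+ j / 1) * ε
      growth {ε} {N} h 0≤ε zero = ≤-from 0ℚ ≤-refl
        (cong (λ z → S⁺ N + z) (sym (*-zeroˡ ε)))
      growth {ε} {N} h 0≤ε (suc j) = begin
        S⁺ m + S m * r m                       ≤⟨ +-mono-≤ (growth h 0≤ε j) (≤-trans
          (*-monoˡ-≤-nonNeg (S m) {{ℚ.nonNegative (nonNeg m)}} (r≤g m))
          (h m (ℕ.m≤n+m N j))) ⟩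
        S⁺ N + (+ j / 1) * ε + ε               ≡⟨ solve 3 (λ s x e → s :+ x :* e :+ e := s :+ (x :+ con 1ℚ) :* e) refl (S⁺ N) (+ j / 1) ε ⟩
        S⁺ N + (+ j / 1 + 1ℚ) * ε              ≤⟨ +-monoʳ-≤ (S⁺ N) (*-monoʳ-≤-nonNeg ε {{ℚ.nonNegative 0≤ε}} j+1≤) ⟩
        S⁺ N + (+ suc j / 1) * ε               ∎
        where
        m = j ℕ.+ N
        j+1≤ : + j / 1 + 1ℚ ≤ + suc j / 1
        j+1≤ = ≤-trans (≤-reflexive (frac+ j 1 1 1)) (frac≤ (j ℕ.* 1 ℕ.+ 1) 1 (suc j) 1
          (ℕ.≤-reflexive (cong (ℕ._* 1) (trans (cong (ℕ._+ 1) (ℕ.*-identityʳ j)) (ℕ.+-comm j 1)))))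

      jg≤2 : ∀ j N → (+ j / 1) * g (j ℕ.+ N) ≤ + 2 / 1
      jg≤2 j N = ≤-trans (≤-reflexive (frac* j 1 2 (suc (j ℕ.+ N))))
        (frac≤ (j ℕ.* 2) (1 ℕ.* suc (j ℕ.+ N)) 2 1 j2≤)
        where
        j2≤ : j ℕ.* 2 ℕ.* 1 ℕ.≤ 2 ℕ.* (1 ℕ.* suc (j ℕ.+ N))
        j2≤ rewrite ℕ.*-identityʳ (j ℕ.* 2) | ℕ.*-comm j 2 | ℕ.+-identityʳ (j ℕ.+ N) =
          ℕ.*-monoʳ-≤ 2 (ℕ.≤-trans (ℕ.m≤m+n j N) (ℕ.n≤1+n (j ℕ.+ N)))

      S⁺g≤ : ∀ {ε δ N M} → δ > 0ℚ → (+ 2 / 1) * δ ≡ ε * ½ →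
        (∀ n → N ℕ.≤ n → S n * g n ≤ δ) →
        (∀ n → M ℕ.≤ n → S⁺ N * g n ≤ ε * ½) →
        ∀ j → M ℕ.≤ j ℕ.+ N → S⁺ (j ℕ.+ N) * g (j ℕ.+ N) ≤ ε
      S⁺g≤ {ε} {δ} {N} δ>0 2δ≡ h h′ j m≥ = begin
        S⁺ m * g m                              ≤⟨ *-monoʳ-≤-nonNeg (g m) {{ℚ.nonNegative (g≥0 m)}} (growth h (<⇒≤ δ>0) j) ⟩
        (S⁺ N + (+ j / 1) * δ) * g m            ≡⟨ solve 4 (λ s x d y → (s :+ x :* d) :* y := s :* y :+ (x :* y) :* d) refl (S⁺ N) (+ j / 1) δ (g m) ⟩
        S⁺ N * g m + ((+ j / 1) * g m) * δ      ≤⟨ +-mono-≤ (h′ m m≥) (*-monoʳ-≤-nonNeg δ {{ℚ.nonNegative (<⇒≤ δ>0)}} (jg≤2 j N)) ⟩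
        ε * ½ + (+ 2 / 1) * δ                   ≡⟨ cong (λ z → ε * ½ + z) 2δ≡ ⟩
        ε * ½ + ε * ½                           ≡⟨ half+half ε ⟩
        ε                                       ∎
        where m = j ℕ.+ N

      S⁺-null : Null (λ n → S⁺ n * g n)
      S⁺-null ε ε>0 =
        let δ , δ>0 , 2δ≡ = divide {+ 2 / 1} (positive⁻¹ (+ 2 / 1)) (half>0 ε>0)
            N , h         = null δ δ>0
            M , h′        = null-scale (S⁺ N) (S⁺≥0 N) g≥0 null-g (ε * ½) (half>0 ε>0)
        in N ℕ.+ M , λ n n≥ →
          let n≡ = ℕ.m∸n+n≡m (ℕ.≤-trans (ℕ.m≤m+n N M) n≥)
          in subst (λ m → S⁺ m * g m ≤ ε) n≡ (S⁺g≤ δ>0 2δ≡ h h′ (n ℕ.∸ N)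
               (subst (M ℕ.≤_) (sym n≡) (ℕ.≤-trans (ℕ.m≤n+m M N) n≥)))

      U⁺-drop : ∀ n → S⁺ n * w n + (S⁺ (suc n) * g (suc n) + U (suc n)) ≤ S⁺ n * g n + U n
      U⁺-drop n = begin
        S⁺ n * w n + ((S⁺ n + S n * r n) * g (suc n) + U (suc n))
          ≡⟨ solve 6 (λ s⁺ x y s r u → s⁺ :* (x :- y) :+ ((s⁺ :+ s :* r) :* y :+ u)
                                        := s⁺ :* x :+ (s :* (r :* y) :+ u))
               refl (S⁺ n) (g n) (g (suc n)) (S n) (r n) (U (suc n)) ⟩
        S⁺ n * g n + (S n * (r n * g (suc n)) + U (suc n))
          ≤⟨ +-monoʳ-≤ (S⁺ n * g n) (+-monoˡ-≤ (U (suc n))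
               (*-monoˡ-≤-nonNeg (S n) {{ℚ.nonNegative (nonNeg n)}} (rg≤w n))) ⟩
        S⁺ n * g n + (S n * w n + U (suc n))
          ≤⟨ +-monoʳ-≤ (S⁺ n * g n) (U-drop n) ⟩
        S⁺ n * g n + U n ∎

    tStep-tame : Tame (tStep S k)
    tStep-tame = record
      { nonNeg = S⁺≥0
      ; null   = S⁺-null
      ; U      = λ n → S⁺ n * g n + U n
      ; U≥0    = λ n → +-nonNeg (*-nonNeg (S⁺≥0 n) (g≥0 n)) (U≥0 n)
      ; U-null = null-+ S⁺-null U-null
      ; U-drop = U⁺-drop
      }

foldl-tame : ∀ {S ks} → Tame S → All (1 ℕ.≤_) ks → Tame (foldl tStep S ks)
foldl-tame tame []           = tame
foldl-tame tame (1≤k ∷ 1≤ks) = foldl-tame (tStep-tame tame 1≤k) 1≤ks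

ζ-cauchy : ∀ s → 1 ℕ.< s → Cauchy (ζSum s)
ζ-cauchy s 1<s = telescope {P = ζSum s} {a = λ n → 1/ suc n ^ s} (λ _ → refl)
  (λ n → frac≥0 1 (suc n ℕ.^ s) {{ℕ.m^n≢0 (suc n) s}}) g≥0 null-g
  (λ n → ≤-trans (+-monoˡ-≤ (g (suc n))
     (w-large (suc n ℕ.^ s) n {{ℕ.m^n≢0 (suc n) s}} (square-large n (suc n) s ℕ.≤-refl 1<s)))
     (≤-reflexive (solve 2 (λ x y → x :- y :+ y := x) refl (g n) (g (suc n)))))
  where open ℚSolver.+-*-Solver

-- The Dirichlet series; only integer arguments s > 1 are needed.
ζ : (s : ℕ) → 1 ℕ.< s → ℝ
ζ s 1<s = mkℝ (ζSum s) (ζ-cauchy s 1<s)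

-- Positive indices, the last one exceeding 1; these make the series converge.
data Admissible : List ℕ → Set where
  empty : Admissible []
  snoc  : ∀ {ks k} → All (1 ℕ.≤_) ks → 1 ℕ.< k → Admissible (ks ∷ʳ k)

tSum-cauchy : ∀ {ks} → Admissible ks → Cauchy (tSum ks)
tSum-cauchy empty = cauchy-const 1ℚ
tSum-cauchy (snoc {ks} {k} 1≤ks 1<k) =
  subst Cauchy (sym (foldl-∷ʳ tStep (λ _ → 1ℚ) k ks))
    (tStep-cauchy (foldl-tame tame-1 1≤ks) 1<k)

t : (ks : List ℕ) → Admissible ks → ℝ
t ks adm = mkℝ (tSum ks) (tSum-cauchy adm)

twos : ℕ → List ℕ
twos r = replicate r 2

twos-positive : ∀ r → All (1 ℕ.≤_) (twos r)
twos-positive r = All.replicate⁺ r (s≤s z≤n)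

twos-∷ʳ : ∀ r → twos r ∷ʳ 2 ≡ twos (suc r)
twos-∷ʳ zero    = refl
twos-∷ʳ (suc r) = cong (2 ∷_) (twos-∷ʳ r)

twos-admissible : ∀ r → Admissible (twos r)
twos-admissible zero    = empty
twos-admissible (suc r) =
  subst Admissible (twos-∷ʳ r) (snoc (twos-positive r) (s≤s (s≤s z≤n)))

twos-3-admissible : ∀ r → Admissible (twos r ∷ʳ 3)
twos-3-admissible r = snoc (twos-positive r) (s≤s (s≤s z≤n))

1<2k+1 : ∀ k → .{{NonZero k}} → 1 ℕ.< 2 ℕ.* k ℕ.+ 1
1<2k+1 (suc k) = s≤s (ℕ.m≤n+m 1 (k ℕ.+ suc (k ℕ.+ 0)))

[-1]^_ : ℕ → ℚ
[-1]^ n = (-1ℤ ℤ.^ n) / 1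

-- d r k is the coefficient d with lower indices r, 0 and upper index k; _C_
-- vanishes when its second argument exceeds the first.
d : (r k : ℕ) → ℚ
d r k = + ((2 ℕ.* k) C (2 ℕ.* r ℕ.+ 1)) / 1
      + (1ℚ - 1/ 2 ^ (2 ℕ.* k)) * (+ (2 ℕ.* k) / 1)

{-# OPTIONS --safe #-}

-- Write P_N(Y) = ∏_{n≤N} (1 + Y/(2n-1)²), whose coefficient of Y^r is the N-th partial sum of t(2,…,2).
-- After Y = -x² the theorem is the coefficientwise form of
--   ∑_n P_{n-1}(Y)/(2n-1)³ = ∑_{k≥1} 8k (1 - (-1)^k P_∞(Y))/(4k² + Y)²,
-- since ∑ (-1)^(k-1)/k^s = (1 - 2^(1-s)) ζ(s).  It has an exact version for finite N: with
--   w_m(k) = ∏_{j≤m} (1 - 4k²/(2j-1)²)⁻¹,   l_m(k) = ∑_{j≤m} (1/(2j-1-2k) - 1/(2j-1+2k)),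
-- the differences in N of
--   R_N = 2 l_N(k) w_N(k) P_N(Y)/(4k² + Y) - 8k w_N(k) P_N(Y)/(4k² + Y)²
-- are 2 l_N(k) w_N(k) P_{N-1}(Y)/(2N-1)², and ∑_k 2 l_m(k) w_m(k) telescopes in k with sum 1/(2m-1).
-- Summing over m ≤ N and k ≤ 2N leaves three errors, which vanish as N → ∞ because the tails of the
-- telescoping sums at k = 2N are O(m/N), l_N(k) w_N(k) = O(k/N) and w_N(k) - (-1)^k = O(k²/N).
module Submission where

open import Defs

module TruncatedSums where

  open import Algebra.Properties.Group using (∙-cancelʳ; ⁻¹-involutive)
  open import Data.Integer.Base as ℤ using (+_; -1ℤ)
  import Data.Integer.Properties as ℤ
  open import Data.List.Base using ([]; _∷ʳ_)
  open import Data.List.Properties using (foldl-∷ʳ)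
  open import Data.List.Relation.Unary.All using ([]; _∷_)
  import Data.List.Relation.Unary.All.Properties as All
  open import Data.Nat.Base as ℕ using (ℕ; zero; suc)
  open import Data.Nat.Combinatorics using (_C_; nC1≡n; nCk≡nC[n∸k]; k>n⇒nCk≡0)
  import Data.Nat.Properties as ℕ
  open import Data.Product.Base using (_,_)
  open import Data.Rational.Base as ℚ
    using (ℚ; 0ℚ; 1ℚ; ½; _/_; _+_; _*_; _-_; -_; _≤_; ∣_∣)
  open import Data.Rational.Properties
  import Data.Rational.Solver as ℚSolver
  open import Data.Sum.Base using (inj₁; inj₂)
  open import Relation.Binary.PropositionalEquality
    using (_≡_; refl; sym; trans; cong; cong₂; subst; subst₂; module ≡-Reasoning)
  open ℚSolver.+-*-Solver using (Polynomial; solve; con; _:=_; _:+_; _:*_; _:-_; :-_)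

  -- Rational arithmetic: identities modulo relations, reciprocals of odd integers.

  private
    +-cancelʳ = ∙-cancelʳ +-0-group
    neg-involutive = ⁻¹-involutive +-0-group

  -- A ring solver cannot use relations such as `oddℚ n * 1/odd n ≡ 1ℚ`. Adding a multiple c of such
  -- a relation to both sides turns the goal into a polynomial identity; chained uses form an
  -- ideal-membership certificate with the arguments c as cofactors.
  linear-combination : ∀ {p q} → p ≡ q → ∀ c {a b} → a + c * p ≡ b + c * q → a ≡ b
  linear-combination {p} refl c {a} {b} = +-cancelʳ (c * p) a b

  2ℚ 4ℚ 8ℚ ¼ : ℚ
  2ℚ = + 2 / 1
  4ℚ = + 4 / 1
  8ℚ = + 8 / 1
  ¼ = + 1 / 4

  opaque
    -- Opaque, so that these numbers stay atoms instead of unfolding to normalised fractions.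
    -- Indices start at 0: `1/odd n` is 1/(2j-1) for j = n+1.
    ι : ℕ → ℚ
    ι n = + n / 1

    1/suc : ℕ → ℚ
    1/suc n = + 1 / suc n

    1/odd : ℕ → ℚ
    1/odd n = + 1 / suc (2 ℕ.* n)

  opaque
    unfolding ι

    ι≡ : ∀ n → ι n ≡ + n / 1
    ι≡ n = refl

    ι-zero : ι 0 ≡ 0ℚ
    ι-zero = refl

    ι-suc : ∀ n → ι (suc n) ≡ ι n + 1ℚ
    ι-suc n = sym (trans (frac+ n 1 1 1)
      (cong (λ m → + m / 1) (trans (cong (ℕ._+ 1) (ℕ.*-identityʳ n)) (ℕ.+-comm n 1))))

    ι-+ : ∀ m n → ι (m ℕ.+ n) ≡ ι m + ι n
    ι-+ m n = sym (trans (frac+ m 1 n 1)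
      (cong (λ k → + k / 1) (cong₂ ℕ._+_ (ℕ.*-identityʳ m) (ℕ.*-identityʳ n))))

    ι-* : ∀ m n → ι (m ℕ.* n) ≡ ι m * ι n
    ι-* m n = sym (frac* m 1 n 1)

    ι≥0 : ∀ n → 0ℚ ≤ ι n
    ι≥0 n = frac≥0 n 1

    ι*1/ : ∀ n → .{{_ : ℕ.NonZero n}} → ι n * (+ 1 / n) ≡ 1ℚ
    ι*1/ n@(suc _) = trans (frac* n 1 1 n)
      (≤-antisym (frac≤ (n ℕ.* 1) (1 ℕ.* n) 1 1 (ℕ.≤-reflexive eq))
                 (frac≤ 1 1 (n ℕ.* 1) (1 ℕ.* n) (ℕ.≤-reflexive (sym eq))))
      where
      eq : n ℕ.* 1 ℕ.* 1 ≡ 1 ℕ.* (1 ℕ.* n)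
      eq = trans (ℕ.*-identityʳ (n ℕ.* 1)) (trans (ℕ.*-comm n 1) (sym (ℕ.*-identityˡ (1 ℕ.* n))))

  oddℚ : ℕ → ℚ
  oddℚ n = 2ℚ * ι n + 1ℚ

  -- This is 2j-1-2k for j = m+1; being odd, it never vanishes.
  gap : ℕ → ℕ → ℚ
  gap m k = 2ℚ * ι m - 2ℚ * ι k + 1ℚ

  :odd : ∀ {n} → Polynomial n → Polynomial n
  :odd m = con 2ℚ :* m :+ con 1ℚ

  :gap : ∀ {n} → Polynomial n → Polynomial n → Polynomial n
  :gap m k = con 2ℚ :* m :- con 2ℚ :* k :+ con 1ℚ

  opaque
    unfolding ι 1/suc 1/odd

    1/suc≡ : ∀ n → 1/suc n ≡ + 1 / suc n
    1/suc≡ n = refl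

    1/odd≡ : ∀ n → 1/odd n ≡ + 1 / suc (2 ℕ.* n)
    1/odd≡ n = refl

    ι-suc-inverse : ∀ n → ι (suc n) * 1/suc n ≡ 1ℚ
    ι-suc-inverse n = ι*1/ (suc n)

    oddℚ-inverse : ∀ n → oddℚ n * 1/odd n ≡ 1ℚ
    oddℚ-inverse n = trans
      (cong (_* 1/odd n) (sym (trans (ι-suc (2 ℕ.* n)) (cong (_+ 1ℚ) (ι-* 2 n)))))
      (ι*1/ (suc (2 ℕ.* n)))

    1/suc≥0 : ∀ n → 0ℚ ≤ 1/suc n
    1/suc≥0 n = frac≥0 1 (suc n)

    1/odd≥0 : ∀ n → 0ℚ ≤ 1/odd n
    1/odd≥0 n = frac≥0 1 (suc (2 ℕ.* n))

    1/odd-anti : ∀ {m n} → m ℕ.≤ n → 1/odd n ≤ 1/odd m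
    1/odd-anti {m} {n} m≤n = frac≤ 1 (suc (2 ℕ.* n)) 1 (suc (2 ℕ.* m))
      (ℕ.*-monoʳ-≤ 1 (ℕ.s≤s (ℕ.*-monoʳ-≤ 2 m≤n)))

    1/suc≤2/odd : ∀ n → 1/suc n ≤ 2ℚ * 1/odd n
    1/suc≤2/odd n = ≤-trans (frac≤ 1 (suc n) (2 ℕ.* 1) (1 ℕ.* suc (2 ℕ.* n)) (begin
      1 ℕ.* (1 ℕ.* suc (2 ℕ.* n))   ≡⟨ trans (ℕ.*-identityˡ _) (ℕ.*-identityˡ _) ⟩
      suc (2 ℕ.* n)                 ≤⟨ ℕ.n≤1+n _ ⟩
      2 ℕ.+ 2 ℕ.* n                 ≡⟨ sym (ℕ.*-suc 2 n) ⟩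
      2 ℕ.* suc n                   ∎)) (≤-reflexive (sym (frac* 2 1 1 (suc (2 ℕ.* n)))))
      where open ℕ.≤-Reasoning

    1/odd≤g : ∀ n → 1/odd n ≤ g n
    1/odd≤g n = frac≤ 1 (suc (2 ℕ.* n)) 2 (suc n) (ℕ.*-mono-≤ {1} {2} (ℕ.s≤s ℕ.z≤n)
      (ℕ.s≤s (ℕ.m≤m+n n (n ℕ.+ 0))))

    2/odd≤g-double : ∀ n → 2ℚ * 1/odd n ≤ g (n ℕ.+ n)
    2/odd≤g-double n = ≤-trans (≤-reflexive (frac* 2 1 1 (suc (2 ℕ.* n))))
      (frac≤ (2 ℕ.* 1) (1 ℕ.* suc (2 ℕ.* n)) 2 (suc (n ℕ.+ n)) (ℕ.≤-reflexive eq))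
      where
      eq : 2 ℕ.* 1 ℕ.* suc (n ℕ.+ n) ≡ 2 ℕ.* (1 ℕ.* suc (2 ℕ.* n))
      eq = cong (2 ℕ.*_) (trans (cong (λ m → suc (n ℕ.+ m)) (sym (ℕ.+-identityʳ n))) (sym (ℕ.*-identityˡ _)))

  -- The weights, their logarithmic derivatives and the recursions for both.

  gap-suc-suc : ∀ m k → gap (suc m) (suc k) ≡ gap m k
  gap-suc-suc m k rewrite ι-suc m | ι-suc k =
    solve 2 (λ m k → :gap (m :+ con 1ℚ) (k :+ con 1ℚ) := :gap m k) refl (ι m) (ι k)

  -- Lowering both indices preserves 2m-2k+1, so the recursion ends at an odd integer whose sign is
  -- known.
  1/gap : ℕ → ℕ → ℚ
  1/gap m       zero    = 1/odd m
  1/gap zero    (suc k) = - 1/odd k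
  1/gap (suc m) (suc k) = 1/gap m k

  gap-inverse : ∀ m k → gap m k * 1/gap m k ≡ 1ℚ
  gap-inverse m zero rewrite ι-zero = trans
    (solve 2 (λ m u → :gap m (con 0ℚ) :* u := :odd m :* u) refl (ι m) (1/odd m))
    (oddℚ-inverse m)
  gap-inverse zero (suc k) rewrite ι-zero | ι-suc k = trans
    (solve 2 (λ k u → :gap (con 0ℚ) (k :+ con 1ℚ) :* (:- u) := :odd k :* u) refl (ι k) (1/odd k))
    (oddℚ-inverse k)
  gap-inverse (suc m) (suc k) = trans (cong (_* 1/gap m k) (gap-suc-suc m k)) (gap-inverse m k)

  -- Since `gap m k` = -`gap k (suc m)`; this links the increments of `logDeriv` in m to those in k.
  1/gap-antisym : ∀ m k → 1/gap m k ≡ - 1/gap k (suc m)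
  1/gap-antisym m       zero    = sym (neg-involutive (1/odd m))
  1/gap-antisym zero    (suc k) = refl
  1/gap-antisym (suc m) (suc k) = 1/gap-antisym m k

  -- weight m k = ∏_{j≤m} (1 - 4k²/(2j-1)²)⁻¹ and logDeriv m k = ∑_{j≤m} (1/(2j-1-2k) - 1/(2j-1+2k)),
  -- its logarithmic derivative in 2k.  The recursion in k gives bounds uniform in k, the one in m below
  -- gives the identities.
  weight : ℕ → ℕ → ℚ
  weight m zero    = 1ℚ
  weight m (suc k) = weight m k * gap k m * 1/odd (k ℕ.+ m)

  logDeriv : ℕ → ℕ → ℚ
  logDeriv m zero    = 0ℚ
  logDeriv m (suc k) = logDeriv m k + 1/gap k m - 1/odd (k ℕ.+ m)

  weight-zero : ∀ k → weight 0 k ≡ 1ℚ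
  weight-zero zero = refl
  weight-zero (suc k) rewrite weight-zero k | ℕ.+-identityʳ k | ι-zero = trans
    (solve 2 (λ k u → con 1ℚ :* :gap k (con 0ℚ) :* u := :odd k :* u) refl (ι k) (1/odd k))
    (oddℚ-inverse k)

  logDeriv-zero : ∀ k → logDeriv 0 k ≡ 0ℚ
  logDeriv-zero zero = refl
  logDeriv-zero (suc k) rewrite logDeriv-zero k | ℕ.+-identityʳ k =
    solve 1 (λ u → con 0ℚ :+ u :- u := con 0ℚ) refl (1/odd k)

  -- The factor for j = m+1 with denominators cleared, as (2m+1)² - 4k² = (2m+1-2k)(2m+1+2k). In the
  -- induction on k, `gap k (suc m)` = -`gap m k` and `gap m (suc k)` = -`gap k m` reconcile the two
  -- recursions.
  weight-suc : ∀ m k → weight (suc m) k * (gap m k * oddℚ (m ℕ.+ k)) ≡ weight m k * (oddℚ m * oddℚ m)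
  weight-suc m zero rewrite ℕ.+-identityʳ m | ι-zero =
    solve 1 (λ m → con 1ℚ :* (:gap m (con 0ℚ) :* :odd m) := con 1ℚ :* (:odd m :* :odd m)) refl (ι m)
  weight-suc m (suc k) rewrite ℕ.+-suc m k | ℕ.+-suc k m | ℕ.+-comm k m | ι-suc m | ι-suc k =
    linear-combination (oddℚ-inverse (suc (m ℕ.+ k))) (- (a * gap m k * gap k m))
    (linear-combination (weight-suc m k) (- (gap k m * u))
    (linear-combination (oddℚ-inverse (m ℕ.+ k)) (a * gap m k * gap k m)
    (solve 8 (λ m k s s′ a v u u′ →
        let m′ = m :+ con 1ℚ; k′ = k :+ con 1ℚ in
        a :* :gap k m′ :* u′ :* (:gap m k′ :* :odd s′)
          :+ :- (a :* :gap m k :* :gap k m) :* (:odd s′ :* u′)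
          :+ :- (:gap k m :* u) :* (a :* (:gap m k :* :odd s))
          :+ a :* :gap m k :* :gap k m :* (:odd s :* u)
        := v :* :gap k m :* u :* (:odd m :* :odd m)
          :+ :- (a :* :gap m k :* :gap k m) :* con 1ℚ
          :+ :- (:gap k m :* u) :* (v :* (:odd m :* :odd m))
          :+ a :* :gap m k :* :gap k m :* con 1ℚ) refl
        (ι m) (ι k) (ι (m ℕ.+ k)) (ι (suc (m ℕ.+ k))) a (weight m k) u (1/odd (suc (m ℕ.+ k))))))
    where
    a = weight (suc m) k
    u = 1/odd (m ℕ.+ k)

  -- In the induction on k, a step in m and a step in k can be taken in either order; in each order
  -- the two `1/gap` terms cancel by antisymmetry.
  logDeriv-suc : ∀ m k → logDeriv (suc m) k ≡ logDeriv m k + 1/gap m k - 1/odd (m ℕ.+ k)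
  logDeriv-suc m zero rewrite ℕ.+-identityʳ m =
    solve 1 (λ u → con 0ℚ := con 0ℚ :+ u :- u) refl (1/odd m)
  logDeriv-suc m (suc k)
    rewrite logDeriv-suc m k | ℕ.+-suc m k | ℕ.+-suc k m | ℕ.+-comm k m
          | 1/gap-antisym k m | 1/gap-antisym m k =
    solve 5 (λ l x y u u′ → l :+ :- y :- u :+ y :- u′ := l :+ :- x :- u :+ x :- u′) refl
      (logDeriv m k) (1/gap m (suc k)) (1/gap k (suc m)) (1/odd (m ℕ.+ k)) (1/odd (suc (m ℕ.+ k)))

  module _ (m k : ℕ) where
    private
      v = weight m k
      v′ = weight (suc m) k
      G = gap m k
      h = 1/gap m k
      S = oddℚ (m ℕ.+ k)
      s = 1/odd (m ℕ.+ k)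
      u = 1/odd m

    weight-ratio : v′ * (1ℚ - 4ℚ * ι k * ι k * (u * u)) ≡ v
    weight-ratio =
      linear-combination (weight-suc m k) (- (u * u))
      -- With x = `oddℚ m * u`, the relation x = 1 is needed in the form x² = 1; the cofactor
      -- supplies the factor x + 1 of x² - 1.
      (linear-combination (oddℚ-inverse m) ((v′ - v) * (oddℚ m * u + 1ℚ))
      identity)
      where
      identity : v′ * (1ℚ - 4ℚ * ι k * ι k * (u * u)) + (- (u * u)) * (v′ * (G * S))
                   + (v′ - v) * (oddℚ m * u + 1ℚ) * (oddℚ m * u)
               ≡ v + (- (u * u)) * (v * (oddℚ m * oddℚ m)) + (v′ - v) * (oddℚ m * u + 1ℚ) * 1ℚ
      identity rewrite ι-+ m k = solve 5 (λ m k v v′ u →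
        v′ :* (con 1ℚ :- con 4ℚ :* k :* k :* (u :* u))
          :+ (:- (u :* u)) :* (v′ :* (:gap m k :* :odd (m :+ k)))
          :+ (v′ :- v) :* (:odd m :* u :+ con 1ℚ) :* (:odd m :* u)
        := v :+ (:- (u :* u)) :* (v :* (:odd m :* :odd m))
          :+ (v′ :- v) :* (:odd m :* u :+ con 1ℚ) :* con 1ℚ) refl
        (ι m) (ι k) v v′ u

    -- h - s = (S - G)/(G S) with S - G = 4k, and v/(G S) = u² v′ by `weight-suc`.
    logDeriv-increment : (h - s) * v ≡ 4ℚ * ι k * v′ * (u * u)
    logDeriv-increment =
      linear-combination (oddℚ-inverse m) ((h - s) * v * (oddℚ m * u + 1ℚ))
      (linear-combination (weight-suc m k) ((h - s) * (u * u))
      (linear-combination (gap-inverse m k) (- (u * u * v′ * S))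
      (linear-combination (oddℚ-inverse (m ℕ.+ k)) (u * u * v′ * G)
      identity)))
      where
      identity : (h - s) * v + (h - s) * v * (oddℚ m * u + 1ℚ) * (oddℚ m * u)
                   + (h - s) * (u * u) * (v′ * (G * S))
                   + - (u * u * v′ * S) * (G * h) + u * u * v′ * G * (S * s)
               ≡ 4ℚ * ι k * v′ * (u * u) + (h - s) * v * (oddℚ m * u + 1ℚ) * 1ℚ
                   + (h - s) * (u * u) * (v * (oddℚ m * oddℚ m))
                   + - (u * u * v′ * S) * 1ℚ + u * u * v′ * G * 1ℚ
      identity rewrite ι-+ m k = solve 7 (λ m k v v′ u h s →
        let G = :gap m k; S = :odd (m :+ k) in
        (h :- s) :* v :+ (h :- s) :* v :* (:odd m :* u :+ con 1ℚ) :* (:odd m :* u)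
          :+ (h :- s) :* (u :* u) :* (v′ :* (G :* S))
          :+ :- (u :* u :* v′ :* S) :* (G :* h) :+ u :* u :* v′ :* G :* (S :* s)
        := con 4ℚ :* k :* v′ :* (u :* u) :+ (h :- s) :* v :* (:odd m :* u :+ con 1ℚ) :* con 1ℚ
          :+ (h :- s) :* (u :* u) :* (v :* (:odd m :* :odd m))
          :+ :- (u :* u :* v′ :* S) :* con 1ℚ :+ u :* u :* v′ :* G :* con 1ℚ) refl
        (ι m) (ι k) v v′ u h s

  -- Bounds on the weights and their logarithmic derivatives.

  abs-≤ : ∀ {p q} → p ≤ q → - p ≤ q → ∣ p ∣ ≤ q
  abs-≤ {p} p≤q -p≤q with ∣p∣≡p∨∣p∣≡-p p
  ... | inj₁ eq = ≤-trans (≤-reflexive eq) p≤q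
  ... | inj₂ eq = ≤-trans (≤-reflexive eq) -p≤q

  abs-+-≤ : ∀ {p q r s} → ∣ p ∣ ≤ r → ∣ q ∣ ≤ s → ∣ p + q ∣ ≤ r + s
  abs-+-≤ {p} {q} p≤r q≤s = ≤-trans (∣p+q∣≤∣p∣+∣q∣ p q) (+-mono-≤ p≤r q≤s)

  abs-neg-≤ : ∀ {p r} → ∣ p ∣ ≤ r → ∣ - p ∣ ≤ r
  abs-neg-≤ {p} p≤r = ≤-trans (≤-reflexive (∣-p∣≡∣p∣ p)) p≤r

  abs---≤ : ∀ {p q r s} → ∣ p ∣ ≤ r → ∣ q ∣ ≤ s → ∣ p - q ∣ ≤ r + s
  abs---≤ {p} {q} p≤r q≤s = abs-+-≤ {p} {(- q)} p≤r (abs-neg-≤ {q} q≤s)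

  abs-*-≤ : ∀ {p q r s} → ∣ p ∣ ≤ r → ∣ q ∣ ≤ s → ∣ p * q ∣ ≤ r * s
  abs-*-≤ {p} {q} p≤r q≤s = ≤-trans (≤-reflexive (∣p*q∣≡∣p∣*∣q∣ p q))
    (*-mono (0≤∣p∣ p) (≤-trans (0≤∣p∣ q) q≤s) p≤r q≤s)

  abs-nonNeg-≤ : ∀ {p q} → 0ℚ ≤ p → p ≤ q → ∣ p ∣ ≤ q
  abs-nonNeg-≤ 0≤p p≤q = ≤-trans (≤-reflexive (0≤p⇒∣p∣≡p 0≤p)) p≤q

  abs-gap-ratio : ∀ {n k m} → gap k m ≤ oddℚ n → - gap k m ≤ oddℚ n → ∣ gap k m * 1/odd n ∣ ≤ 1ℚ
  abs-gap-ratio {n} {k} {m} ≤₁ ≤₂ = ≤-trans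
    (abs-*-≤ {gap k m} (abs-≤ ≤₁ ≤₂) (abs-nonNeg-≤ (1/odd≥0 n) ≤-refl))
    (≤-reflexive (oddℚ-inverse n))

  4ιn≥0 : ∀ n → 0ℚ ≤ 4ℚ * ι n
  4ιn≥0 n = *-nonNeg (nonNegative⁻¹ 4ℚ) (ι≥0 n)

  abs-gap/odd : ∀ k m → ∣ gap k m * 1/odd (k ℕ.+ m) ∣ ≤ 1ℚ
  abs-gap/odd k m = abs-gap-ratio {k ℕ.+ m} {k} {m}
    (≤-from (4ℚ * ι m) (4ιn≥0 m) upper)
    (≤-from (4ℚ * ι k + 2ℚ) (+-nonNeg (4ιn≥0 k) (nonNegative⁻¹ 2ℚ)) lower)
    where
    upper : gap k m + 4ℚ * ι m ≡ oddℚ (k ℕ.+ m)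
    upper rewrite ι-+ k m =
      solve 2 (λ k m → :gap k m :+ con 4ℚ :* m := :odd (k :+ m)) refl (ι k) (ι m)
    lower : - gap k m + (4ℚ * ι k + 2ℚ) ≡ oddℚ (k ℕ.+ m)
    lower rewrite ι-+ k m =
      solve 2 (λ k m → :- :gap k m :+ (con 4ℚ :* k :+ con 2ℚ) := :odd (k :+ m)) refl (ι k) (ι m)

  -- Each factor of the recursion in k is at most 1 in absolute value, whereas factors of the
  -- product over j can exceed 1.
  abs-weight : ∀ m k → ∣ weight m k ∣ ≤ 1ℚ
  abs-weight m zero    = ≤-refl
  abs-weight m (suc k) = subst (λ z → ∣ z ∣ ≤ 1ℚ)
    (sym (*-assoc (weight m k) (gap k m) (1/odd (k ℕ.+ m))))
    (abs-*-≤ {weight m k} {_} {1ℚ} {1ℚ} (abs-weight m k) (abs-gap/odd k m))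

  -- Bounding the product avoids small denominators: in the step from k to k+1 the increment
  -- `1/gap k m` cancels against the factor `gap k m` of the weight, and the rest adds at most
  -- 2/(2m+1).
  abs-weight-logDeriv : ∀ m k → ∣ weight m k * logDeriv m k ∣ ≤ 2ℚ * ι k * 1/odd m
  abs-weight-logDeriv m zero rewrite ι-zero = ≤-reflexive
    (solve 1 (λ u → con 0ℚ := con 2ℚ :* con 0ℚ :* u) refl (1/odd m))
  abs-weight-logDeriv m (suc k) = begin
    ∣ weight m (suc k) * logDeriv m (suc k) ∣
      ≡⟨ cong ∣_∣ (linear-combination (gap-inverse k m) (- (v * s)) (solve 5 (λ v G h s L →
           v :* G :* s :* (L :+ h :- s) :+ :- (v :* s) :* (G :* h)
           := (G :* s) :* (v :* L) :+ v :* s :- v :* (G :* s) :* s :+ :- (v :* s) :* con 1ℚ)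
           refl v G h s L)) ⟩
    ∣ (G * s) * (v * L) + v * s - v * (G * s) * s ∣
      ≤⟨ abs---≤ {(G * s) * (v * L) + v * s} (abs-+-≤ {(G * s) * (v * L)}
           (abs-*-≤ {G * s} (abs-gap/odd k m) (abs-weight-logDeriv m k))
           (abs-*-≤ {v} (abs-weight m k) s≤u))
           (abs-*-≤ {v * (G * s)} (abs-*-≤ {v} (abs-weight m k) (abs-gap/odd k m)) s≤u) ⟩
    1ℚ * (2ℚ * ι k * u) + 1ℚ * u + 1ℚ * 1ℚ * u
      ≡⟨ solve 2 (λ k u → con 1ℚ :* (con 2ℚ :* k :* u) :+ con 1ℚ :* u :+ con 1ℚ :* con 1ℚ :* u
                      := con 2ℚ :* (k :+ con 1ℚ) :* u) refl (ι k) u ⟩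
    2ℚ * (ι k + 1ℚ) * u
      ≡⟨ cong (λ z → 2ℚ * z * u) (sym (ι-suc k)) ⟩
    2ℚ * ι (suc k) * u ∎
    where
    open ≤-Reasoning
    v = weight m k
    L = logDeriv m k
    G = gap k m
    h = 1/gap k m
    s = 1/odd (k ℕ.+ m)
    u = 1/odd m
    s≤u : ∣ s ∣ ≤ u
    s≤u = abs-nonNeg-≤ (1/odd≥0 (k ℕ.+ m)) (1/odd-anti (ℕ.m≤n+m m k))

  sgn : ℕ → ℚ
  sgn zero    = 1ℚ
  sgn (suc n) = - sgn n

  -- The step ratio of the weight is -1 + (4k+2)/(2k+2m+1), so each step adds at most (4k+2)/(2m+1)
  -- to the distance from the alternating sign; these sum to 2k²/(2m+1).
  abs-weight-sgn : ∀ m k → ∣ weight m k - sgn k ∣ ≤ 2ℚ * (ι k * ι k) * 1/odd m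
  abs-weight-sgn m zero rewrite ι-zero = ≤-reflexive
    (solve 1 (λ u → con 0ℚ := con 2ℚ :* (con 0ℚ :* con 0ℚ) :* u) refl (1/odd m))
  abs-weight-sgn m (suc k) = begin
    ∣ weight m (suc k) - sgn (suc k) ∣
      ≡⟨ cong ∣_∣ rearranged ⟩
    ∣ v * ((4ℚ * ι k + 2ℚ) * s) - (v - sgn k) ∣
      ≤⟨ abs---≤ {v * ((4ℚ * ι k + 2ℚ) * s)}
           (abs-*-≤ {v} (abs-weight m k) (abs-*-≤ {4ℚ * ι k + 2ℚ}
             (abs-nonNeg-≤ (+-nonNeg (4ιn≥0 k) (nonNegative⁻¹ 2ℚ)) ≤-refl)
             (abs-nonNeg-≤ (1/odd≥0 (k ℕ.+ m)) (1/odd-anti (ℕ.m≤n+m m k)))))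
           (abs-weight-sgn m k) ⟩
    1ℚ * ((4ℚ * ι k + 2ℚ) * u) + 2ℚ * (ι k * ι k) * u
      ≡⟨ solve 2 (λ k u → con 1ℚ :* ((con 4ℚ :* k :+ con 2ℚ) :* u) :+ con 2ℚ :* (k :* k) :* u
                      := con 2ℚ :* ((k :+ con 1ℚ) :* (k :+ con 1ℚ)) :* u) refl (ι k) u ⟩
    2ℚ * ((ι k + 1ℚ) * (ι k + 1ℚ)) * u
      ≡⟨ cong (λ z → 2ℚ * (z * z) * u) (sym (ι-suc k)) ⟩
    2ℚ * (ι (suc k) * ι (suc k)) * u ∎
    where
    open ≤-Reasoning
    v = weight m k
    s = 1/odd (k ℕ.+ m)
    u = 1/odd m
    identity : v * gap k m * s - - sgn k + v * (oddℚ (k ℕ.+ m) * s)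
             ≡ v * ((4ℚ * ι k + 2ℚ) * s) - (v - sgn k) + v * 1ℚ
    identity rewrite ι-+ k m = solve 5 (λ k m v s e →
      v :* :gap k m :* s :- :- e :+ v :* (:odd (k :+ m) :* s)
      := v :* ((con 4ℚ :* k :+ con 2ℚ) :* s) :- (v :- e) :+ v :* con 1ℚ) refl
      (ι k) (ι m) v s (sgn k)
    rearranged : weight m (suc k) - sgn (suc k) ≡ v * ((4ℚ * ι k + 2ℚ) * s) - (v - sgn k)
    rearranged = linear-combination (oddℚ-inverse (k ℕ.+ m)) v identity

  -- Telescoping in k

  ∑< : ℕ → (ℕ → ℚ) → ℚ
  ∑< zero    f = 0ℚ
  ∑< (suc n) f = ∑< n f + f n

  -- Up to a constant, the derivative of 1/∏_{|j|≤m} (a + 2j) at a = 2k+1, normalised to 1/(2m+1) at k = 0.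
  tail : ℕ → ℕ → ℚ
  tail m k = weight (suc m) k * (gap k (suc m) * logDeriv (suc m) k + 1ℚ) * 1/odd m

  -- Up to a constant, `weight (suc m) (suc k)` is the difference of the values of 1/∏_{|j|≤m} (a +
  -- 2j) at a = 2k+1 and a = 2k+3. Differentiating this relation gives the telescoping step.
  tail-telescopes : ∀ m n → ∑< n (λ k → 2ℚ * (logDeriv (suc m) (suc k) * weight (suc m) (suc k)))
                          ≡ 1/odd m - tail m n
  tail-telescopes m zero =
    solve 2 (λ G u → con 0ℚ := u :- con 1ℚ :* (G :* con 0ℚ :+ con 1ℚ) :* u) refl
      (gap 0 (suc m)) (1/odd m)
  tail-telescopes m (suc k) rewrite tail-telescopes m k =
    linear-combination (oddℚ-inverse m) (2ℚ * (L′ * v′))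
    (linear-combination (oddℚ-inverse (k ℕ.+ suc m)) (- (v * G * u * L′))
    (linear-combination (gap-inverse k (suc m)) (- (v * u))
    identity))
    where
    v = weight (suc m) k
    L = logDeriv (suc m) k
    G = gap k (suc m)
    h = 1/gap k (suc m)
    S = oddℚ (k ℕ.+ suc m)
    s = 1/odd (k ℕ.+ suc m)
    u = 1/odd m
    L′ = L + h - s
    v′ = v * G * s
    identity : u - v * (G * L + 1ℚ) * u + 2ℚ * (L′ * v′) + 2ℚ * (L′ * v′) * (oddℚ m * u)
                 + - (v * G * u * L′) * (S * s) + - (v * u) * (G * h)
             ≡ u - v′ * (gap (suc k) (suc m) * L′ + 1ℚ) * u + 2ℚ * (L′ * v′) * 1ℚ
                 + - (v * G * u * L′) * 1ℚ + - (v * u) * 1ℚ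
    identity rewrite ι-+ k (suc m) | ι-suc m | ι-suc k = solve 7 (λ m k v L h s u →
      let G = :gap k (m :+ con 1ℚ)
          L′ = L :+ h :- s
          v′ = v :* G :* s in
      u :- v :* (G :* L :+ con 1ℚ) :* u :+ con 2ℚ :* (L′ :* v′)
        :+ con 2ℚ :* (L′ :* v′) :* (:odd m :* u)
        :+ :- (v :* G :* u :* L′) :* (:odd (k :+ (m :+ con 1ℚ)) :* s) :+ :- (v :* u) :* (G :* h)
      := u :- v′ :* (:gap (k :+ con 1ℚ) (m :+ con 1ℚ) :* L′ :+ con 1ℚ) :* u
        :+ con 2ℚ :* (L′ :* v′) :* con 1ℚ
        :+ :- (v :* G :* u :* L′) :* con 1ℚ :+ :- (v :* u) :* con 1ℚ) refl
      (ι m) (ι k) v L h s u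

  -- A constant multiple of 1/∏_{|j|≤m} (a + 2j) at a = 2k+1, equal to -1 at k = 0. The ratio of
  -- consecutive values is (2k-2m+1)/(2k+2m+3), which lies in [-1, 1].
  abs-weight-gap : ∀ m k → ∣ weight (suc m) k * gap k (suc m) * 1/odd m ∣ ≤ 1ℚ
  abs-weight-gap m zero = ≤-reflexive (cong ∣_∣ {y = - 1ℚ} (trans base
    (cong -_ (oddℚ-inverse m))))
    where
    base : 1ℚ * gap 0 (suc m) * 1/odd m ≡ - (oddℚ m * 1/odd m)
    base rewrite ι-zero | ι-suc m = solve 2 (λ m u →
      con 1ℚ :* :gap (con 0ℚ) (m :+ con 1ℚ) :* u := :- (:odd m :* u)) refl (ι m) (1/odd m)
  abs-weight-gap m (suc k) = subst (λ z → ∣ z ∣ ≤ 1ℚ)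
    (solve 5 (λ v G u G′ s → v :* G :* u :* (G′ :* s) := v :* G :* s :* G′ :* u) refl
      (weight (suc m) k) (gap k (suc m)) (1/odd m) (gap (suc k) (suc m)) (1/odd (k ℕ.+ suc m)))
    (abs-*-≤ {_} {_} {1ℚ} {1ℚ} (abs-weight-gap m k) (abs-gap-ratio {k ℕ.+ suc m} {suc k} {suc m}
      (≤-from (4ℚ * ι m + 2ℚ) (+-nonNeg (4ιn≥0 m) (nonNegative⁻¹ 2ℚ)) upper)
      (≤-from (4ℚ * ι k + 4ℚ) (+-nonNeg (4ιn≥0 k) (nonNegative⁻¹ 4ℚ)) lower)))
    where
    upper : gap (suc k) (suc m) + (4ℚ * ι m + 2ℚ) ≡ oddℚ (k ℕ.+ suc m)
    upper rewrite ι-+ k (suc m) | ι-suc m | ι-suc k = solve 2 (λ k m →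
      :gap (k :+ con 1ℚ) (m :+ con 1ℚ) :+ (con 4ℚ :* m :+ con 2ℚ) := :odd (k :+ (m :+ con 1ℚ)))
      refl (ι k) (ι m)
    lower : - gap (suc k) (suc m) + (4ℚ * ι k + 4ℚ) ≡ oddℚ (k ℕ.+ suc m)
    lower rewrite ι-+ k (suc m) | ι-suc m | ι-suc k = solve 2 (λ k m →
      :- :gap (k :+ con 1ℚ) (m :+ con 1ℚ) :+ (con 4ℚ :* k :+ con 4ℚ) := :odd (k :+ (m :+ con 1ℚ)))
      refl (ι k) (ι m)

  1/gap-+ : ∀ m k → 1/gap (m ℕ.+ k) k ≡ 1/odd m
  1/gap-+ m zero    rewrite ℕ.+-identityʳ m = refl
  1/gap-+ m (suc k) rewrite ℕ.+-suc m k = 1/gap-+ m k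

  -- The cutoff k = 2n keeps clear of small denominators: for m < n the gap is -(2o+1) with o =
  -- 2n-m-1 ≥ n.
  abs-1/gap : ∀ {m n} → m ℕ.< n → ∣ 1/gap m (n ℕ.+ n) ∣ ≤ 1/odd n
  abs-1/gap {m} {n} m<n = subst (λ z → ∣ z ∣ ≤ 1/odd n)
    (sym (trans (1/gap-antisym m (n ℕ.+ n)) (cong -_ 1/gap≡1/odd)))
    (abs-neg-≤ {1/odd o} (abs-nonNeg-≤ (1/odd≥0 o) (1/odd-anti n≤o)))
    where
    o = n ℕ.+ n ℕ.∸ suc m
    n≤o : n ℕ.≤ o
    n≤o = subst (ℕ._≤ o) (ℕ.m+n∸n≡m n n) (ℕ.∸-monoʳ-≤ (n ℕ.+ n) m<n)
    1/gap≡1/odd : 1/gap (n ℕ.+ n) (suc m) ≡ 1/odd o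
    1/gap≡1/odd = trans
      (cong (λ z → 1/gap z (suc m)) (sym (ℕ.m∸n+n≡m (ℕ.≤-trans m<n (ℕ.m≤m+n n n)))))
      (1/gap-+ o (suc m))

  abs-logDeriv : ∀ m {n} → m ℕ.≤ n → ∣ logDeriv m (n ℕ.+ n) ∣ ≤ 2ℚ * ι m * 1/odd n
  abs-logDeriv zero {n} _ rewrite logDeriv-zero (n ℕ.+ n) | ι-zero = ≤-reflexive
    (solve 1 (λ u → con 0ℚ := con 2ℚ :* con 0ℚ :* u) refl (1/odd n))
  abs-logDeriv (suc m) {n} m<n rewrite logDeriv-suc m (n ℕ.+ n) | ι-suc m = ≤-trans
    (abs---≤ {logDeriv m (n ℕ.+ n) + 1/gap m (n ℕ.+ n)}
      (abs-+-≤ {logDeriv m (n ℕ.+ n)} (abs-logDeriv m (ℕ.<⇒≤ m<n)) (abs-1/gap m<n))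
      (abs-nonNeg-≤ (1/odd≥0 (m ℕ.+ (n ℕ.+ n))) (1/odd-anti
        (ℕ.≤-trans (ℕ.m≤m+n n n) (ℕ.m≤n+m (n ℕ.+ n) m)))))
    (≤-reflexive (solve 2 (λ m u → con 2ℚ :* m :* u :+ u :+ u := con 2ℚ :* (m :+ con 1ℚ) :* u)
      refl (ι m) (1/odd n)))

  abs-tail : ∀ {m n} → m ℕ.< n → ∣ tail m (n ℕ.+ n) ∣ ≤ oddℚ m * 1/odd n
  abs-tail {m} {n} m<n = subst₂ (λ y z → ∣ y ∣ ≤ z) (sym factored)
    (solve 2 (λ m u → con 1ℚ :* (con 2ℚ :* m :* u :+ u) := :odd m :* u) refl (ι m) (1/odd n))
    (abs-*-≤ {v * G * u} {L - s} (abs-weight-gap m (n ℕ.+ n))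
      (abs---≤ {L} (abs-logDeriv m (ℕ.<⇒≤ m<n))
        (abs-nonNeg-≤ (1/odd≥0 (m ℕ.+ (n ℕ.+ n))) (1/odd-anti
          (ℕ.≤-trans (ℕ.m≤m+n n n) (ℕ.m≤n+m (n ℕ.+ n) m))))))
    where
    v = weight (suc m) (n ℕ.+ n)
    G = gap (n ℕ.+ n) (suc m)
    h = 1/gap (n ℕ.+ n) (suc m)
    L = logDeriv m (n ℕ.+ n)
    s = 1/odd (m ℕ.+ (n ℕ.+ n))
    u = 1/odd m
    -- The last increment of `logDeriv (suc m)` contains -h, and G h = 1 cancels the summand `1ℚ` of
    -- `tail`.
    factored : tail m (n ℕ.+ n) ≡ v * G * u * (L - s)
    factored rewrite logDeriv-suc m (n ℕ.+ n) | 1/gap-antisym m (n ℕ.+ n) =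
      linear-combination (gap-inverse (n ℕ.+ n) (suc m)) (v * u) (solve 6 (λ v G h L s u →
        v :* (G :* (L :+ :- h :- s) :+ con 1ℚ) :* u :+ v :* u :* (G :* h)
        := v :* G :* u :* (L :- s) :+ v :* u :* con 1ℚ) refl v G h L s u)

  -- Partial sums and coefficients of power series

  1/-cong : ∀ {a b} → .{{_ : ℕ.NonZero a}} → .{{_ : ℕ.NonZero b}} → a ≡ b → + 1 / a ≡ + 1 / b
  1/-cong refl = refl

  1/^-suc : ∀ n k → .{{_ : ℕ.NonZero n}} → 1/ n ^ suc k ≡ (+ 1 / n) * 1/ n ^ k
  1/^-suc n k = sym (frac* 1 n 1 (n ℕ.^ k))
    where instance _ = ℕ.m^n≢0 n k

  1/suc^-suc : ∀ n k → 1/ suc n ^ suc k ≡ 1/suc n * 1/ suc n ^ k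
  1/suc^-suc n k = trans (1/^-suc (suc n) k) (cong (_* 1/ suc n ^ k) (sym (1/suc≡ n)))

  1/odd^-suc : ∀ n k → 1/[2 suc n -1]^ suc k ≡ 1/odd n * 1/[2 suc n -1]^ k
  1/odd^-suc n k = trans
    (1/^-suc (odd (suc n)) k {{odd-nonZero (suc n)}})
    (cong (_* 1/[2 suc n -1]^ k)
      (trans (1/-cong {{odd-nonZero (suc n)}} (odd-suc n)) (sym (1/odd≡ n))))

  1/odd^1 : ∀ n → 1/[2 suc n -1]^ 1 ≡ 1/odd n
  1/odd^1 n = trans (1/odd^-suc n 0) (*-identityʳ (1/odd n))

  1/odd^2 : ∀ n → 1/[2 suc n -1]^ 2 ≡ 1/odd n * 1/odd n
  1/odd^2 n = trans (1/odd^-suc n 1) (cong (1/odd n *_) (1/odd^1 n))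

  1/odd^3 : ∀ n → 1/[2 suc n -1]^ 3 ≡ 1/odd n * (1/odd n * 1/odd n)
  1/odd^3 n = trans (1/odd^-suc n 2) (cong (1/odd n *_) (1/odd^2 n))

  ∑≡∑< : ∀ n (f : (k : ℕ) → .{{ℕ.NonZero k}} → ℚ) → ∑ n f ≡ ∑< n (λ i → f (suc i))
  ∑≡∑< zero    f = refl
  ∑≡∑< (suc n) f = cong (_+ f (suc n)) (∑≡∑< n f)

  ∑<-cong : ∀ n {f f′ : ℕ → ℚ} → (∀ i → f i ≡ f′ i) → ∑< n f ≡ ∑< n f′
  ∑<-cong zero    eq = refl
  ∑<-cong (suc n) eq = cong₂ _+_ (∑<-cong n eq) (eq n)

  ∑<-+ : ∀ n f f′ → ∑< n (λ i → f i + f′ i) ≡ ∑< n f + ∑< n f′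
  ∑<-+ zero    f f′ = refl
  ∑<-+ (suc n) f f′ rewrite ∑<-+ n f f′ =
    solve 4 (λ a b c d → a :+ b :+ (c :+ d) := a :+ c :+ (b :+ d)) refl
      (∑< n f) (∑< n f′) (f n) (f′ n)

  ∑<-minus : ∀ n f f′ → ∑< n (λ i → f i - f′ i) ≡ ∑< n f - ∑< n f′
  ∑<-minus zero    f f′ = refl
  ∑<-minus (suc n) f f′ rewrite ∑<-minus n f f′ =
    solve 4 (λ a b c d → a :- b :+ (c :- d) := a :+ c :- (b :+ d)) refl
      (∑< n f) (∑< n f′) (f n) (f′ n)

  ∑<-* : ∀ n c f → ∑< n (λ i → c * f i) ≡ c * ∑< n f
  ∑<-* zero    c f = sym (*-zeroʳ c)
  ∑<-* (suc n) c f rewrite ∑<-* n c f = sym (*-distribˡ-+ c (∑< n f) (f n))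

  ∑<-zero : ∀ n → ∑< n (λ _ → 0ℚ) ≡ 0ℚ
  ∑<-zero zero    = refl
  ∑<-zero (suc n) = cong (_+ 0ℚ) (∑<-zero n)

  ∑<-swap : ∀ m n (f : ℕ → ℕ → ℚ) → ∑< m (λ i → ∑< n (f i)) ≡ ∑< n (λ j → ∑< m (λ i → f i j))
  ∑<-swap zero    n f = sym (∑<-zero n)
  ∑<-swap (suc m) n f = trans (cong (_+ ∑< n (f m)) (∑<-swap m n f))
    (sym (∑<-+ n (λ j → ∑< m (λ i → f i j)) (f m)))

  ∑<-first : ∀ n f → ∑< (suc n) f ≡ f 0 + ∑< n (λ i → f (suc i))
  ∑<-first zero    f = +-comm 0ℚ (f 0)
  ∑<-first (suc n) f = trans (cong (_+ f (suc n)) (∑<-first n f))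
    (+-assoc (f 0) (∑< n (λ i → f (suc i))) (f (suc n)))

  tSum-∷ʳ : ∀ ks k n → tSum (ks ∷ʳ k) n ≡ ∑< n (λ i → tSum ks i * 1/[2 suc i -1]^ k)
  tSum-∷ʳ ks k n = trans (cong (λ S → S n) (foldl-∷ʳ tStep (λ _ → 1ℚ) k ks)) (∑≡∑< n _)

  -- As a function of n, the elementary symmetric polynomial of degree r in 1, 1/3², ..., 1/(2n-1)²,
  -- that is, the coefficient of Y^r in P_n(Y).
  elem : ℕ → ℕ → ℚ
  elem r = tSum (twos r)

  elem-∑< : ∀ r n → elem (suc r) n ≡ ∑< n (λ i → elem r i * (1/odd i * 1/odd i))
  elem-∑< r n = trans (cong (λ ks → tSum ks n) (sym (twos-∷ʳ r)))
    (trans (tSum-∷ʳ (twos r) 2 n) (∑<-cong n (λ i → cong (elem r i *_) (1/odd^2 i))))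

  elem-suc : ∀ r n → elem (suc r) (suc n) ≡ elem (suc r) n + elem r n * (1/odd n * 1/odd n)
  elem-suc r n = trans (elem-∑< r (suc n))
    (cong (_+ elem r n * (1/odd n * 1/odd n)) (sym (elem-∑< r n)))

  -- The coefficients of p(Y)/(Y + q), where x = 1/q.
  quotient : ℚ → (ℕ → ℚ) → ℕ → ℚ
  quotient x p zero    = x * p 0
  quotient x p (suc r) = x * (p (suc r) - quotient x p r)

  quotient-cong : ∀ x {p p′ : ℕ → ℚ} → (∀ r → p r ≡ p′ r) → ∀ r → quotient x p r ≡ quotient x p′ r
  quotient-cong x eq zero    = cong (x *_) (eq 0)
  quotient-cong x eq (suc r) = cong (x *_) (cong₂ _-_ (eq (suc r)) (quotient-cong x eq r))

  quotient-linear : ∀ x a b p s r →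
    quotient x (λ i → a * p i + b * s i) r ≡ a * quotient x p r + b * quotient x s r
  quotient-linear x a b p s zero =
    solve 5 (λ x a b p s → x :* (a :* p :+ b :* s) := a :* (x :* p) :+ b :* (x :* s)) refl
      x a b (p 0) (s 0)
  quotient-linear x a b p s (suc r) rewrite quotient-linear x a b p s r =
    solve 7 (λ x a b p s y z → x :* (a :* p :+ b :* s :- (a :* y :+ b :* z))
                            := a :* (x :* (p :- y)) :+ b :* (x :* (s :- z))) refl
      x a b (p (suc r)) (s (suc r)) (quotient x p r) (quotient x s r)

  -- Here p′ = (1 + cY) p, and 1 + cY = (1 - qc) + c(Y + q).
  quotient-factor : ∀ {x q} c (p p′ : ℕ → ℚ) → x * q ≡ 1ℚ →
    p′ 0 ≡ p 0 → (∀ r → p′ (suc r) ≡ p (suc r) + p r * c) →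
    ∀ r → quotient x p′ r ≡ (1ℚ - q * c) * quotient x p r + c * p r
  quotient-factor {x} {q} c p p′ xq≡1 p₀ p₊ zero rewrite p₀ =
    linear-combination xq≡1 (- (c * p 0)) (solve 4 (λ x q c p →
      x :* p :+ :- (c :* p) :* (x :* q)
        := (con 1ℚ :- q :* c) :* (x :* p) :+ c :* p :+ :- (c :* p) :* con 1ℚ)
      refl x q c (p 0))
  quotient-factor {x} {q} c p p′ xq≡1 p₀ p₊ (suc r)
    rewrite p₊ r | quotient-factor {x} {q} c p p′ xq≡1 p₀ p₊ r =
    linear-combination xq≡1 (- (c * p (suc r))) (solve 6 (λ x q c p₊ p y →
      x :* (p₊ :+ p :* c :- ((con 1ℚ :- q :* c) :* y :+ c :* p)) :+ :- (c :* p₊) :* (x :* q)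
      := (con 1ℚ :- q :* c) :* (x :* (p₊ :- y)) :+ c :* p₊ :+ :- (c :* p₊) :* con 1ℚ)
      refl x q c (p (suc r)) (p r) (quotient x p r))

  -- The coefficients of 1/(Y + q).
  alternating : ℚ → ℕ → ℚ
  alternating x zero    = x
  alternating x (suc i) = - (x * alternating x i)

  quotient-convolution : ∀ x p r → quotient x p r ≡ ∑< (suc r) (λ i → alternating x i * p (r ℕ.∸ i))
  quotient-convolution x p zero    = sym (+-identityˡ (x * p 0))
  quotient-convolution x p (suc r) = begin
    x * (p (suc r) - quotient x p r)
      ≡⟨ cong (λ z → x * (p (suc r) - z)) (quotient-convolution x p r) ⟩
    x * (p (suc r) - ∑< (suc r) f)
      ≡⟨ solve 3 (λ x p s → x :* (p :- s) := x :* p :+ (:- x) :* s) refl x (p (suc r)) (∑< (suc r) f) ⟩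
    x * p (suc r) + (- x) * ∑< (suc r) f
      ≡⟨ cong (λ z → x * p (suc r) + z) (trans (sym (∑<-* (suc r) (- x) f))
           (∑<-cong (suc r) (λ i → solve 3 (λ x y z → (:- x) :* (y :* z) := :- (x :* y) :* z) refl
             x (alternating x i) (p (r ℕ.∸ i))))) ⟩
    x * p (suc r) + ∑< (suc r) (λ i → - (x * alternating x i) * p (r ℕ.∸ i))
      ≡⟨ sym (∑<-first (suc r) (λ i → alternating x i * p (suc r ℕ.∸ i))) ⟩
    ∑< (suc (suc r)) (λ i → alternating x i * p (suc r ℕ.∸ i)) ∎
    where
    open ≡-Reasoning
    f : ℕ → ℚ
    f i = alternating x i * p (r ℕ.∸ i)

  -- The coefficients of 1/(Y + q)² = -d/dY 1/(Y + q) are (i+1)(-1)^i x^(i+2).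
  quotient²-convolution : ∀ x p r → quotient x (quotient x p) r
    ≡ ∑< (suc r) (λ i → ι (suc i) * x * alternating x i * p (r ℕ.∸ i))
  quotient²-convolution x p zero rewrite ι-suc 0 | ι-zero =
    solve 2 (λ x p → x :* (x :* p) := con 0ℚ :+ (con 0ℚ :+ con 1ℚ) :* x :* x :* p) refl x (p 0)
  quotient²-convolution x p (suc r) = begin
    x * (quotient x p (suc r) - quotient x (quotient x p) r)
      ≡⟨ cong₂ (λ y z → x * (y - z))
           (trans (quotient-convolution x p (suc r)) (∑<-first (suc r) (λ i → alternating x i * p (suc r ℕ.∸ i))))
           (quotient²-convolution x p r) ⟩
    x * (x * p (suc r) + ∑< (suc r) f₁ - ∑< (suc r) f₂)
      ≡⟨ solve 4 (λ x p s t → x :* (x :* p :+ s :- t) := (con 0ℚ :+ con 1ℚ) :* x :* x :* p :+ (x :* s :+ (:- x) :* t))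
           refl x (p (suc r)) (∑< (suc r) f₁) (∑< (suc r) f₂) ⟩
    (0ℚ + 1ℚ) * x * x * p (suc r) + (x * ∑< (suc r) f₁ + (- x) * ∑< (suc r) f₂)
      ≡⟨ cong₂ _+_
           (cong (λ z → z * x * x * p (suc r)) (sym (trans (ι-suc 0) (cong (_+ 1ℚ) ι-zero))))
           (trans (cong₂ _+_ (sym (∑<-* (suc r) x f₁)) (sym (∑<-* (suc r) (- x) f₂)))
             (trans (sym (∑<-+ (suc r) (λ i → x * f₁ i) (λ i → (- x) * f₂ i)))
               (∑<-cong (suc r) combine))) ⟩
    ι 1 * x * x * p (suc r) + ∑< (suc r) (λ i → ι (suc (suc i)) * x * alternating x (suc i) * p (r ℕ.∸ i))
      ≡⟨ sym (∑<-first (suc r) (λ i → ι (suc i) * x * alternating x i * p (suc r ℕ.∸ i))) ⟩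
    ∑< (suc (suc r)) (λ i → ι (suc i) * x * alternating x i * p (suc r ℕ.∸ i)) ∎
    where
    open ≡-Reasoning
    f₁ f₂ : ℕ → ℚ
    f₁ i = alternating x (suc i) * p (r ℕ.∸ i)
    f₂ i = ι (suc i) * x * alternating x i * p (r ℕ.∸ i)
    combine : ∀ i → x * f₁ i + (- x) * f₂ i ≡ ι (suc (suc i)) * x * alternating x (suc i) * p (r ℕ.∸ i)
    combine i rewrite ι-suc (suc i) = solve 4 (λ n x a p →
      x :* (:- (x :* a) :* p) :+ (:- x) :* (n :* x :* a :* p) := (n :+ con 1ℚ) :* x :* (:- (x :* a)) :* p) refl
      (ι (suc i)) x (alternating x i) (p (r ℕ.∸ i))

  -- The identity for a single k

  -- Dividing by Y + q turns multiplication by 1 + cY into an affine recursion, with f = 1 - qc.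
  remainder-step : ∀ {L′ Q′ QQ′ v} K L δ v′ c f Q QQ e →
    L′ ≡ L + δ → v′ * f ≡ v → δ * v ≡ 4ℚ * K * v′ * c →
    Q′ ≡ f * Q + c * e → QQ′ ≡ f * QQ + c * Q →
    2ℚ * (L′ * v′) * Q′ - 8ℚ * K * v′ * QQ′
      ≡ 2ℚ * (L * v) * Q - 8ℚ * K * v * QQ + 2ℚ * (L′ * v′) * (e * c)
  remainder-step {v = v} K L δ v′ c f Q QQ e refl v′f≡v δv≡ refl refl = begin
    2ℚ * ((L + δ) * v′) * (f * Q + c * e) - 8ℚ * K * v′ * (f * QQ + c * Q)
      ≡⟨ cong₂ _-_ (distribute (2ℚ * ((L + δ) * v′)) f Q c e) (distribute (8ℚ * K * v′) f QQ c Q) ⟩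
    a * f * Q + a * c * e - (8ℚ * K * v′ * f * QQ + 8ℚ * K * v′ * c * Q)
      -- The increment of L produces 2 δ v Q, which equals 8 K v′ c Q; the two cancel in the next
      -- step.
      ≡⟨ cong₂ (λ y z → y * Q + a * c * e - z)
           (linear-combination v′f≡v (- (2ℚ * (L + δ))) {a * f} {2ℚ * (L * v) + 2ℚ * (δ * v)} (solve 5 (λ L δ v v′ f →
             con 2ℚ :* ((L :+ δ) :* v′) :* f :+ :- (con 2ℚ :* (L :+ δ)) :* (v′ :* f)
             := con 2ℚ :* (L :* v) :+ con 2ℚ :* (δ :* v) :+ :- (con 2ℚ :* (L :+ δ)) :* v)
             refl L δ v v′ f))
           (cong₂ (λ y z → y * QQ + z * Q)
             (trans (*-assoc (8ℚ * K) v′ f) (cong (8ℚ * K *_) v′f≡v))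
             (linear-combination δv≡ 2ℚ {8ℚ * K * v′ * c} {2ℚ * (δ * v)} (solve 4 (λ K v′ c z →
               con 8ℚ :* K :* v′ :* c :+ con 2ℚ :* z
               := con 2ℚ :* z :+ con 2ℚ :* (con 4ℚ :* K :* v′ :* c)) refl
               K v′ c (δ * v)))) ⟩
    (2ℚ * (L * v) + 2ℚ * (δ * v)) * Q + a * c * e - (8ℚ * K * v * QQ + 2ℚ * (δ * v) * Q)
      ≡⟨ solve 7 (λ x y z Q QQ b e → (x :+ z) :* Q :+ b :* e :- (y :* QQ :+ z :* Q)
                              := x :* Q :- y :* QQ :+ b :* e) refl
           (2ℚ * (L * v)) (8ℚ * K * v) (2ℚ * (δ * v)) Q QQ (a * c) e ⟩
    2ℚ * (L * v) * Q - 8ℚ * K * v * QQ + a * c * e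
      ≡⟨ cong (λ z → 2ℚ * (L * v) * Q - 8ℚ * K * v * QQ + z)
           (trans (*-assoc a c e) (cong (a *_) (*-comm c e))) ⟩
    2ℚ * (L * v) * Q - 8ℚ * K * v * QQ + a * (e * c) ∎
    where
    open ≡-Reasoning
    a = 2ℚ * ((L + δ) * v′)
    distribute : ∀ a f y c z → a * (f * y + c * z) ≡ a * f * y + a * c * z
    distribute = solve 5 (λ a f y c z → a :* (f :* y :+ c :* z) := a :* f :* y :+ a :* c :* z) refl

  module _ (i : ℕ) where
    private
      K = ι (suc i)
      κ = 1/suc i

    -- q = 4k² with k = i+1, so `elem/q n` and `elem/q² n` hold the coefficients of P_n(Y)/(4k² + Y)
    -- and P_n(Y)/(4k² + Y)².
    1/q : ℚ
    1/q = ¼ * (κ * κ)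

    1/q-inverse : 1/q * (4ℚ * K * K) ≡ 1ℚ
    1/q-inverse = linear-combination (ι-suc-inverse i) (- (K * κ + 1ℚ)) (solve 2 (λ K κ →
      con ¼ :* (κ :* κ) :* (con 4ℚ :* K :* K) :+ :- (K :* κ :+ con 1ℚ) :* (K :* κ)
      := con 1ℚ :+ :- (K :* κ :+ con 1ℚ) :* con 1ℚ) refl K κ)

    elem/q : ℕ → ℕ → ℚ
    elem/q n = quotient 1/q (λ r → elem r n)

    elem/q-suc : ∀ n r → elem/q (suc n) r
      ≡ (1ℚ - 4ℚ * K * K * (1/odd n * 1/odd n)) * elem/q n r + 1/odd n * 1/odd n * elem r n
    elem/q-suc n = quotient-factor (1/odd n * 1/odd n) (λ r → elem r n) (λ r → elem r (suc n))
      1/q-inverse refl (λ r → elem-suc r n)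

    elem/q² : ℕ → ℕ → ℚ
    elem/q² n = quotient 1/q (elem/q n)

    elem/q²-suc : ∀ n r → elem/q² (suc n) r
      ≡ (1ℚ - 4ℚ * K * K * (1/odd n * 1/odd n)) * elem/q² n r + 1/odd n * 1/odd n * elem/q n r
    elem/q²-suc n r = trans (quotient-cong 1/q (elem/q-suc n) r)
      (quotient-linear 1/q (1ℚ - 4ℚ * K * K * (1/odd n * 1/odd n)) (1/odd n * 1/odd n)
        (elem/q n) (λ r → elem r n) r)

    remainder : ℕ → ℕ → ℚ
    remainder r n = 2ℚ * (logDeriv n (suc i) * weight n (suc i)) * elem/q n r
                  - 8ℚ * K * weight n (suc i) * elem/q² n r

    remainder-suc : ∀ r n → remainder r (suc n) ≡ remainder r n
      + 2ℚ * (logDeriv (suc n) (suc i) * weight (suc n) (suc i)) * (elem r n * (1/odd n * 1/odd n))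
    remainder-suc r n = remainder-step K (logDeriv n (suc i)) (1/gap n (suc i) - 1/odd (n ℕ.+ suc i))
      (weight (suc n) (suc i)) (1/odd n * 1/odd n) _ (elem/q n r) (elem/q² n r) (elem r n)
      (trans (logDeriv-suc n (suc i)) (+-assoc (logDeriv n (suc i)) (1/gap n (suc i)) _))
      (weight-ratio n (suc i)) (logDeriv-increment n (suc i)) (elem/q-suc n r) (elem/q²-suc n r)

    -- Telescopes `remainder-suc`. As `logDeriv 0` vanishes and `weight 0` is 1, the starting value
    -- is -8k times the coefficient of Y^r in 1/(4k² + Y)².
    remainder-sum : ∀ r n →
      ∑< n (λ m → 2ℚ * (logDeriv (suc m) (suc i) * weight (suc m) (suc i)) * (elem r m * (1/odd m * 1/odd m)))
      ≡ remainder r n + 8ℚ * K * elem/q² 0 r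
    remainder-sum r zero = trans
      (solve 3 (λ K Q QQ → con 0ℚ := con 2ℚ :* (con 0ℚ :* con 1ℚ) :* Q :- con 8ℚ :* K :* con 1ℚ :* QQ
                                  :+ con 8ℚ :* K :* QQ) refl K (elem/q 0 r) (elem/q² 0 r))
      (cong₂ (λ l v → 2ℚ * (l * v) * elem/q 0 r - 8ℚ * K * v * elem/q² 0 r + 8ℚ * K * elem/q² 0 r)
        (sym (logDeriv-zero (suc i))) (sym (weight-zero (suc i))))
    remainder-sum r (suc n) = trans
      (cong (_+ new) (remainder-sum r n))
      (trans (exchange (remainder r n) _ new) (cong (_+ 8ℚ * K * elem/q² 0 r) (sym (remainder-suc r n))))
      where
      new = 2ℚ * (logDeriv (suc n) (suc i) * weight (suc n) (suc i)) * (elem r n * (1/odd n * 1/odd n))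
      exchange : ∀ a b c → a + b + c ≡ a + c + b
      exchange = solve 3 (λ a b c → a :+ b :+ c := a :+ c :+ b) refl

  -- Expansion in inverse powers of k.

  1/suc^-even-suc : ∀ n k → 1/ suc n ^ (2 ℕ.* suc k) ≡ 1/suc n * 1/suc n * 1/ suc n ^ (2 ℕ.* k)
  1/suc^-even-suc n k = trans (cong (λ j → 1/ suc n ^ j) (ℕ.*-suc 2 k))
    (trans (1/suc^-suc n (suc (2 ℕ.* k)))
      (trans (cong (1/suc n *_) (1/suc^-suc n (2 ℕ.* k)))
        (sym (*-assoc (1/suc n) (1/suc n) (1/ suc n ^ (2 ℕ.* k))))))

  1/suc^-odd : ∀ n k → 1/ suc n ^ (2 ℕ.* k ℕ.+ 1) ≡ 1/suc n * 1/ suc n ^ (2 ℕ.* k)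
  1/suc^-odd n k = trans (cong (λ j → 1/ suc n ^ j) (ℕ.+-comm (2 ℕ.* k) 1)) (1/suc^-suc n (2 ℕ.* k))

  -- With k = j+1 this is the factor (-1)^(k+1)/2^(2k) of the theorem.
  signed¼ : ℕ → ℚ
  signed¼ j = sgn j * 1/ 2 ^ (2 ℕ.* suc j)

  signed¼-suc : ∀ j → signed¼ (suc j) ≡ - (¼ * signed¼ j)
  signed¼-suc j = trans
    (cong (- sgn j *_) (trans (1/suc^-even-suc 1 (suc j)) (cong (λ z → z * z * P) (1/suc≡ 1))))
    (rearrange (sgn j) P)
    where
    P = 1/ 2 ^ (2 ℕ.* suc j)
    rearrange : ∀ s p → - s * (½ * ½ * p) ≡ - (¼ * (s * p))
    rearrange = solve 2 (λ s p → (:- s) :* (con ½ :* con ½ :* p) := :- (con ¼ :* (s :* p))) refl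

  alternating-closed : ∀ i j → alternating (1/q i) j ≡ signed¼ j * 1/ suc i ^ (2 ℕ.* suc j)
  alternating-closed i zero = trans
    (rearrange (1/suc i * 1/suc i)) (cong (1ℚ * ¼ *_) (sym (1/suc^-even-suc i 0)))
    where
    rearrange : ∀ κ → ¼ * κ ≡ 1ℚ * ¼ * (κ * 1ℚ)
    rearrange = solve 1 (λ κ → con ¼ :* κ := con 1ℚ :* con ¼ :* (κ :* con 1ℚ)) refl
  alternating-closed i (suc j) = trans
    (cong (λ z → - (¼ * (1/suc i * 1/suc i) * z)) (alternating-closed i j))
    (trans (rearrange (1/suc i * 1/suc i) (signed¼ j) (1/ suc i ^ (2 ℕ.* suc j)))
      (cong₂ _*_ (sym (signed¼-suc j)) (sym (1/suc^-even-suc i (suc j)))))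
    where
    rearrange : ∀ κ s p → - (¼ * κ * (s * p)) ≡ - (¼ * s) * (κ * p)
    rearrange = solve 3 (λ κ s p → :- (con ¼ :* κ :* (s :* p)) := :- (con ¼ :* s) :* (κ :* p)) refl

  -- Summation over k

  ∑<-*ʳ : ∀ n c f → ∑< n (λ i → f i * c) ≡ ∑< n f * c
  ∑<-*ʳ n c f = trans (∑<-cong n (λ i → *-comm (f i) c)) (trans (∑<-* n c f) (*-comm c (∑< n f)))

  -- With n = 2N and N growing, the first sum tends to 0. In the second, the weight at k tends to
  -- (-1)^k, and the minus sign makes the limit ∑ (-1)^(k-1)/k^s.
  weightedLogSum weightedSum : (n N j : ℕ) → ℚ
  weightedLogSum n N j = ∑< n (λ i → 1/ suc i ^ (2 ℕ.* suc j) * (weight N (suc i) * logDeriv N (suc i)))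
  weightedSum    n N j = ∑< n (λ i → 1/ suc i ^ (2 ℕ.* suc j ℕ.+ 1) * - weight N (suc i))

  zetaSum : (n j : ℕ) → ℚ
  zetaSum n j = ∑< n (λ i → 1/ suc i ^ (2 ℕ.* suc j ℕ.+ 1))

  -- The first two terms come from the two halves of `remainder` at N, the third from its starting
  -- value, where `elem (r ℕ.∸ j) 0` is 1 for j = r and 0 for j < r.
  coefficient : (r n N j : ℕ) → ℚ
  coefficient r n N j =
    2ℚ * elem (r ℕ.∸ j) N * weightedLogSum n N j
    + 2ℚ * (ι (suc j) * elem (r ℕ.∸ j) N) * weightedSum n N j
    + 2ℚ * (ι (suc j) * elem (r ℕ.∸ j) 0) * zetaSum n j

  summand : (r N i j : ℕ) → ℚ
  summand r N i j = signed¼ j *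
    (2ℚ * elem (r ℕ.∸ j) N * (1/ suc i ^ (2 ℕ.* suc j) * (weight N (suc i) * logDeriv N (suc i)))
    + 2ℚ * (ι (suc j) * elem (r ℕ.∸ j) N) * (1/ suc i ^ (2 ℕ.* suc j ℕ.+ 1) * - weight N (suc i))
    + 2ℚ * (ι (suc j) * elem (r ℕ.∸ j) 0) * 1/ suc i ^ (2 ℕ.* suc j ℕ.+ 1))

  summand-sum : ∀ r N n j → ∑< n (λ i → summand r N i j) ≡ signed¼ j * coefficient r n N j
  summand-sum r N n j = trans (∑<-* n (signed¼ j) _) (cong (signed¼ j *_)
    (trans (∑<-+ n _ _) (cong₂ _+_
      (trans (∑<-+ n _ _) (cong₂ _+_
        (∑<-* n (2ℚ * elem (r ℕ.∸ j) N) _)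
        (∑<-* n (2ℚ * (ι (suc j) * elem (r ℕ.∸ j) N)) _)))
      (∑<-* n (2ℚ * (ι (suc j) * elem (r ℕ.∸ j) 0)) _))))

  -- The factor 8k and the extra 1/(4k²) of the squared denominator combine to 2/k, which raises the
  -- even exponent of 1/k to the odd argument of the zeta value.
  cancel-κ : ∀ K κ s P n e → K * κ ≡ 1ℚ →
    8ℚ * K * (n * (¼ * (κ * κ)) * (s * P) * e) ≡ s * (2ℚ * (n * e) * (κ * P))
  cancel-κ K κ s P n e Kκ≡1 = trans (factor K κ s P n e)
    (trans (cong (_* (s * (2ℚ * (n * e) * (κ * P)))) Kκ≡1) (*-identityˡ _))
    where
    factor : ∀ K κ s P n e → 8ℚ * K * (n * (¼ * (κ * κ)) * (s * P) * e)
                           ≡ K * κ * (s * (2ℚ * (n * e) * (κ * P)))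
    factor = solve 6 (λ K κ s P n e →
      con 8ℚ :* K :* (n :* (con ¼ :* (κ :* κ)) :* (s :* P) :* e)
      := K :* κ :* (s :* (con 2ℚ :* (n :* e) :* (κ :* P)))) refl

  remainder-expansion : ∀ r N i →
    remainder i r N + 8ℚ * ι (suc i) * elem/q² i 0 r ≡ ∑< (suc r) (summand r N i)
  remainder-expansion r N i = begin
    a * elem/q i N r - 8ℚ * K * v * elem/q² i N r + 8ℚ * K * elem/q² i 0 r
      ≡⟨ regroup a (8ℚ * K) v (elem/q i N r) (elem/q² i N r) (elem/q² i 0 r) ⟩
    a * elem/q i N r + - v * (8ℚ * K * elem/q² i N r) + 8ℚ * K * elem/q² i 0 r
      ≡⟨ cong₂ _+_ (cong₂ _+_ (cong (a *_) (quotient-convolution x (λ r → elem r N) r))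
           (cong (- v *_) (expand N))) (expand 0) ⟩
    a * ∑< (suc r) f₁ + - v * ∑< (suc r) (f₂ N) + ∑< (suc r) (f₂ 0)
      ≡⟨ sym (trans (∑<-+ (suc r) _ _) (cong (_+ ∑< (suc r) (f₂ 0)) (trans (∑<-+ (suc r) _ _)
           (cong₂ _+_ (∑<-* (suc r) a f₁) (∑<-* (suc r) (- v) (f₂ N)))))) ⟩
    ∑< (suc r) (λ j → a * f₁ j + - v * f₂ N j + f₂ 0 j)
      ≡⟨ ∑<-cong (suc r) pointwise ⟩
    ∑< (suc r) (summand r N i) ∎
    where
    open ≡-Reasoning
    K = ι (suc i)
    x = 1/q i
    v = weight N (suc i)
    l = logDeriv N (suc i)
    a = 2ℚ * (l * v)
    f₁ : ℕ → ℚ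
    f₁ j = alternating x j * elem (r ℕ.∸ j) N
    f₂ : ℕ → ℕ → ℚ
    f₂ n j = 8ℚ * K * (ι (suc j) * x * alternating x j * elem (r ℕ.∸ j) n)
    expand : ∀ n → 8ℚ * K * elem/q² i n r ≡ ∑< (suc r) (f₂ n)
    expand n = trans (cong (8ℚ * K *_) (quotient²-convolution x (λ r → elem r n) r))
      (sym (∑<-* (suc r) (8ℚ * K) _))
    regroup : ∀ a b v p q r → a * p - b * v * q + b * r ≡ a * p + - v * (b * q) + b * r
    regroup = solve 6 (λ a b v p q r → a :* p :- b :* v :* q :+ b :* r
                                    := a :* p :+ (:- v) :* (b :* q) :+ b :* r) refl
    f₂≡ : ∀ n j → f₂ n j ≡ signed¼ j * (2ℚ * (ι (suc j) * elem (r ℕ.∸ j) n) * 1/ suc i ^ (2 ℕ.* suc j ℕ.+ 1))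
    f₂≡ n j = trans
      (cong (λ z → 8ℚ * K * (ι (suc j) * x * z * elem (r ℕ.∸ j) n)) (alternating-closed i j))
      (trans (cancel-κ K (1/suc i) (signed¼ j) (1/ suc i ^ (2 ℕ.* suc j)) (ι (suc j)) (elem (r ℕ.∸ j) n)
               (ι-suc-inverse i))
        (cong (λ z → signed¼ j * (2ℚ * (ι (suc j) * elem (r ℕ.∸ j) n) * z)) (sym (1/suc^-odd i (suc j)))))
    collect : ∀ l v s P e b c → 2ℚ * (l * v) * (s * P * e) + - v * (s * b) + s * c
                              ≡ s * (2ℚ * e * (P * (v * l)) + - v * b + c)
    collect = solve 7 (λ l v s P e b c → con 2ℚ :* (l :* v) :* (s :* P :* e) :+ (:- v) :* (s :* b) :+ s :* c
                         := s :* (con 2ℚ :* e :* (P :* (v :* l)) :+ (:- v) :* b :+ c)) refl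
    move : ∀ v y z → - v * (y * z) ≡ y * (z * - v)
    move = solve 3 (λ v y z → (:- v) :* (y :* z) := y :* (z :* (:- v))) refl
    pointwise : ∀ j → a * f₁ j + - v * f₂ N j + f₂ 0 j ≡ summand r N i j
    pointwise j = trans
      (cong₂ _+_ (cong₂ (λ y z → a * (y * elem (r ℕ.∸ j) N) + - v * z) (alternating-closed i j) (f₂≡ N j)) (f₂≡ 0 j))
      (trans (collect l v (signed¼ j) (1/ suc i ^ (2 ℕ.* suc j)) (elem (r ℕ.∸ j) N) _ _)
        (cong (λ z → signed¼ j * (2ℚ * elem (r ℕ.∸ j) N * (1/ suc i ^ (2 ℕ.* suc j) * (v * l)) + z
            + 2ℚ * (ι (suc j) * elem (r ℕ.∸ j) 0) * 1/ suc i ^ (2 ℕ.* suc j ℕ.+ 1)))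
          (move v (2ℚ * (ι (suc j) * elem (r ℕ.∸ j) N)) (1/ suc i ^ (2 ℕ.* suc j ℕ.+ 1)))))

  tailSum : (r n N : ℕ) → ℚ
  tailSum r n N = ∑< N (λ m → tail m n * (elem r m * (1/odd m * 1/odd m)))

  -- Exact for all n and N: one factor 1/(2m+1) of the cube is replaced by its telescoped sum over k
  -- ≤ n plus `tail m n`, and the sums over m and k are interchanged.
  tSum-twos-3 : ∀ r n N →
    tSum (twos r ∷ʳ 3) N ≡ tailSum r n N + ∑< (suc r) (λ j → signed¼ j * coefficient r n N j)
  tSum-twos-3 r n N = begin
    tSum (twos r ∷ʳ 3) N
      ≡⟨ tSum-∷ʳ (twos r) 3 N ⟩
    ∑< N (λ m → elem r m * 1/[2 suc m -1]^ 3)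
      ≡⟨ ∑<-cong N split ⟩
    ∑< N (λ m → tail m n * E m + ∑< n (λ i → c i m * E m))
      ≡⟨ ∑<-+ N _ _ ⟩
    tailSum r n N + ∑< N (λ m → ∑< n (λ i → c i m * E m))
      ≡⟨ cong (λ z → tailSum r n N + z) (trans (∑<-swap N n _) (∑<-cong n (λ i →
           trans (remainder-sum i r N) (remainder-expansion r N i)))) ⟩
    tailSum r n N + ∑< n (λ i → ∑< (suc r) (summand r N i))
      ≡⟨ cong (λ z → tailSum r n N + z) (trans (∑<-swap n (suc r) _) (∑<-cong (suc r) (summand-sum r N n))) ⟩
    tailSum r n N + ∑< (suc r) (λ j → signed¼ j * coefficient r n N j) ∎
    where
    open ≡-Reasoning
    E : ℕ → ℚ
    E m = elem r m * (1/odd m * 1/odd m)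
    c : ℕ → ℕ → ℚ
    c i m = 2ℚ * (logDeriv (suc m) (suc i) * weight (suc m) (suc i))
    cube : ∀ e u T → e * (u * (u * u)) ≡ T * (e * (u * u)) + (u - T) * (e * (u * u))
    cube = solve 3 (λ e u T → e :* (u :* (u :* u)) := T :* (e :* (u :* u)) :+ (u :- T) :* (e :* (u :* u))) refl
    split : ∀ m → elem r m * 1/[2 suc m -1]^ 3 ≡ tail m n * E m + ∑< n (λ i → c i m * E m)
    split m = trans (cong (elem r m *_) (1/odd^3 m))
      (trans (cube (elem r m) (1/odd m) (tail m n))
        (cong (λ z → tail m n * E m + z) (trans (cong (_* E m) (sym (tail-telescopes m n)))
          (sym (∑<-*ʳ n (E m) (λ i → c i m))))))

  -- Passage to the limit

  Vanishing : (ℕ → ℚ) → Set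
  Vanishing x = Null (λ n → ∣ x n ∣)

  null-≤ : ∀ {u v : ℕ → ℚ} → (∀ n → u n ≤ v n) → Null v → Null u
  null-≤ u≤v null ε ε>0 with null ε ε>0
  ... | N , h = N , λ n n≥ → ≤-trans (u≤v n) (h n n≥)

  null-double : ∀ {u} → Null u → Null (λ n → u (n ℕ.+ n))
  null-double null ε ε>0 with null ε ε>0
  ... | N , h = N , λ n n≥ → h (n ℕ.+ n) (ℕ.≤-trans n≥ (ℕ.m≤m+n n n))

  vanishing-cong : ∀ {x y : ℕ → ℚ} → (∀ n → x n ≡ y n) → Vanishing x → Vanishing y
  vanishing-cong eq = null-≤ (λ n → ≤-reflexive (cong ∣_∣ (sym (eq n))))

  vanishing-+ : ∀ {x y} → Vanishing x → Vanishing y → Vanishing (λ n → x n + y n)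
  vanishing-+ {x} {y} vx vy = null-≤ (λ n → ∣p+q∣≤∣p∣+∣q∣ (x n) (y n)) (null-+ vx vy)

  vanishing-*-cauchy : ∀ {x y} → Cauchy x → Vanishing y → Vanishing (λ n → x n * y n)
  vanishing-*-cauchy {x} {y} cx vy ε ε>0 =
    let b , b>0 , M , bound = eventually-bounded {x} cx
        δ , δ>0 , bδ≡ε      = divide b>0 ε>0
        N , h               = vy δ δ>0
    in M ℕ.+ N , λ n n≥ → subst (∣ x n * y n ∣ ≤_) bδ≡ε
         (abs-*-≤ {x n} (bound n (ℕ.≤-trans (ℕ.m≤m+n M N) n≥)) (h n (ℕ.≤-trans (ℕ.m≤n+m N M) n≥)))

  vanishing-∑< : ∀ m {f : ℕ → ℕ → ℚ} → (∀ j → j ℕ.< m → Vanishing (λ n → f n j)) →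
    Vanishing (λ n → ∑< m (f n))
  vanishing-∑< zero    vf ε ε>0 = 0 , λ _ _ → <⇒≤ ε>0
  vanishing-∑< (suc m) {f} vf = vanishing-+ {λ n → ∑< m (f n)} {λ n → f n m}
    (vanishing-∑< m (λ j j<m → vf j (ℕ.m<n⇒m<1+n j<m))) (vf m ℕ.≤-refl)

  vanishing-double-difference : ∀ {x} → Cauchy x → Vanishing (λ n → x (n ℕ.+ n) - x n)
  vanishing-double-difference {x} cx ε ε>0 with cx ε ε>0
  ... | N , h = N , λ n n≥ → h (n ℕ.+ n) n (ℕ.≤-trans n≥ (ℕ.m≤m+n n n)) n≥

  abs-∑< : ∀ n {f h : ℕ → ℚ} → (∀ i → i ℕ.< n → ∣ f i ∣ ≤ h i) → ∣ ∑< n f ∣ ≤ ∑< n h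
  abs-∑< zero    f≤h = ≤-refl
  abs-∑< (suc n) {f} f≤h = abs-+-≤ {∑< n f} (abs-∑< n (λ i i<n → f≤h i (ℕ.m<n⇒m<1+n i<n))) (f≤h n ℕ.≤-refl)

  elem-tame : ∀ r → Tame (elem r)
  elem-tame r = foldl-tame tame-1 (twos-positive r)

  elem-cauchy : ∀ r → Cauchy (elem r)
  elem-cauchy r = tSum-cauchy (twos-admissible r)

  -- The bound (2m+1)/(2n+1) on the tail cancels one power of 1/(2m+1). What remains is 1/(2n+1)
  -- times a partial sum of the divergent t(2,...,2,1), which grows slowly enough by `Tame.null`.
  vanishing-tailSum : ∀ r → Vanishing (λ n → tailSum r (n ℕ.+ n) n)
  vanishing-tailSum r = null-≤ bound (Tame.null tame)
    where
    tame : Tame (tSum (twos r ∷ʳ 1))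
    tame = foldl-tame tame-1 (All.∷ʳ⁺ (twos-positive r) ℕ.≤-refl)
    rearrange : ∀ o u w e → o * w * (e * (u * u)) ≡ o * u * (e * u * w)
    rearrange = solve 4 (λ o u w e → o :* w :* (e :* (u :* u)) := o :* u :* (e :* u :* w)) refl
    term : ∀ n m → m ℕ.< n → ∣ tail m (n ℕ.+ n) * (elem r m * (1/odd m * 1/odd m)) ∣
                           ≤ elem r m * 1/odd m * 1/odd n
    term n m m<n = ≤-trans
      (abs-*-≤ {tail m (n ℕ.+ n)} (abs-tail m<n) (abs-nonNeg-≤
        (*-nonNeg (Tame.nonNeg (elem-tame r) m) (*-nonNeg (1/odd≥0 m) (1/odd≥0 m))) ≤-refl))
      (≤-reflexive (trans (rearrange (oddℚ m) (1/odd m) (1/odd n) (elem r m))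
        (trans (cong (_* (elem r m * 1/odd m * 1/odd n)) (oddℚ-inverse m)) (*-identityˡ _))))
    bound : ∀ n → ∣ tailSum r (n ℕ.+ n) n ∣ ≤ tSum (twos r ∷ʳ 1) n * g n
    bound n = begin
      ∣ tailSum r (n ℕ.+ n) n ∣                              ≤⟨ abs-∑< n (term n) ⟩
      ∑< n (λ m → elem r m * 1/odd m * 1/odd n)              ≡⟨ ∑<-*ʳ n (1/odd n) _ ⟩
      ∑< n (λ m → elem r m * 1/odd m) * 1/odd n              ≡⟨ cong (_* 1/odd n) (sym (trans
        (tSum-∷ʳ (twos r) 1 n) (∑<-cong n (λ m → cong (elem r m *_) (1/odd^1 m))))) ⟩
      tSum (twos r ∷ʳ 1) n * 1/odd n                         ≤⟨ *-monoˡ-≤-nonNeg (tSum (twos r ∷ʳ 1) n)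
        {{ℚ.nonNegative (Tame.nonNeg tame n)}} (1/odd≤g n) ⟩
      tSum (twos r ∷ʳ 1) n * g n                             ∎
      where open ≤-Reasoning

  -- Error terms of the sums over k.

  harmonic : ℕ → ℚ
  harmonic n = ∑< n 1/suc

  -- Harmonic sums are at most twice the partial sums of the divergent t(1), which are tame;
  -- 2/(2n+1) is the value of `g` at 2n.
  null-harmonic : Null (λ n → harmonic (n ℕ.+ n) * (2ℚ * 1/odd n))
  null-harmonic = null-≤ bound (null-scale 2ℚ (nonNegative⁻¹ 2ℚ)
    (λ n → *-nonNeg (Tame.nonNeg tame (n ℕ.+ n)) (g≥0 (n ℕ.+ n))) (null-double (Tame.null tame)))
    where
    S : ℕ → ℚ
    S = tSum ([] ∷ʳ 1)
    tame : Tame S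
    tame = foldl-tame tame-1 (ℕ.≤-refl ∷ [])
    harmonic≤ : ∀ n → harmonic n ≤ 2ℚ * S n
    harmonic≤ n = subst (harmonic n ≤_)
      (trans (∑<-* n 2ℚ 1/odd) (cong (2ℚ *_) (sym (trans (tSum-∷ʳ [] 1 n)
        (∑<-cong n (λ i → trans (*-identityˡ (1/[2 suc i -1]^ 1)) (1/odd^1 i)))))))
      (≤-trans (p≤∣p∣ (harmonic n)) (abs-∑< n (λ i _ → abs-nonNeg-≤ (1/suc≥0 i) (1/suc≤2/odd i))))
      where
      p≤∣p∣ : ∀ p → p ≤ ∣ p ∣
      p≤∣p∣ p with ≤-total 0ℚ p
      ... | inj₁ 0≤p = ≤-reflexive (sym (0≤p⇒∣p∣≡p 0≤p))
      ... | inj₂ p≤0 = ≤-trans p≤0 (0≤∣p∣ p)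
    bound : ∀ n → harmonic (n ℕ.+ n) * (2ℚ * 1/odd n) ≤ 2ℚ * (S (n ℕ.+ n) * g (n ℕ.+ n))
    bound n = ≤-trans (≤-trans
      (*-monoʳ-≤-nonNeg (2ℚ * 1/odd n) {{ℚ.nonNegative (*-nonNeg (nonNegative⁻¹ 2ℚ) (1/odd≥0 n))}}
        (harmonic≤ (n ℕ.+ n)))
      (*-monoˡ-≤-nonNeg (2ℚ * S (n ℕ.+ n))
        {{ℚ.nonNegative (*-nonNeg (nonNegative⁻¹ 2ℚ) (Tame.nonNeg tame (n ℕ.+ n)))}} (2/odd≤g-double n)))
      (≤-reflexive (*-assoc 2ℚ (S (n ℕ.+ n)) (g (n ℕ.+ n))))

  abs-1/suc^ : ∀ i k → ∣ 1/ suc i ^ k ∣ ≤ 1ℚ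
  abs-1/suc^ i k = abs-nonNeg-≤ (frac≥0 1 (suc i ℕ.^ k)) (frac≤ 1 (suc i ℕ.^ k) 1 1
    (ℕ.*-monoʳ-≤ 1 (ℕ.m^n>0 (suc i) k)))
    where instance _ = ℕ.m^n≢0 (suc i) k

  abs-1/suc : ∀ i → ∣ 1/suc i ∣ ≤ 1/suc i
  abs-1/suc i = abs-nonNeg-≤ (1/suc≥0 i) ≤-refl

  abs-1/suc^-even : ∀ i j → ∣ 1/ suc i ^ (2 ℕ.* suc j) ∣ ≤ 1/suc i * 1/suc i
  abs-1/suc^-even i j = subst₂ (λ y z → ∣ y ∣ ≤ z) (sym (1/suc^-even-suc i j)) (*-identityʳ _)
    (abs-*-≤ {1/suc i * 1/suc i} (abs-*-≤ {1/suc i} (abs-1/suc i) (abs-1/suc i)) (abs-1/suc^ i (2 ℕ.* j)))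

  abs-1/suc^-odd : ∀ i j → ∣ 1/ suc i ^ (2 ℕ.* suc j ℕ.+ 1) ∣ ≤ 1/suc i * (1/suc i * 1/suc i)
  abs-1/suc^-odd i j = subst (λ y → ∣ y ∣ ≤ 1/suc i * (1/suc i * 1/suc i)) (sym (1/suc^-odd i (suc j)))
    (abs-*-≤ {1/suc i} (abs-1/suc i) (abs-1/suc^-even i j))

  -- The bound 2k/(2n+1) costs one power of k; even against 1/k² this leaves a harmonic sum over k ≤
  -- 2n, times 2/(2n+1).
  vanishing-weightedLogSum : ∀ j → Vanishing (λ n → weightedLogSum (n ℕ.+ n) n j)
  vanishing-weightedLogSum j = null-≤ (λ n → ≤-trans
    (abs-∑< (n ℕ.+ n) (λ i _ → ≤-trans
      (abs-*-≤ {1/ suc i ^ (2 ℕ.* suc j)} (abs-1/suc^-even i j) (abs-weight-logDeriv n (suc i)))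
      (≤-reflexive (trans (rearrange (ι (suc i)) (1/suc i) (1/odd n))
        (trans (cong (_* (1/suc i * (2ℚ * 1/odd n))) (ι-suc-inverse i)) (*-identityˡ _))))))
    (≤-reflexive (∑<-*ʳ (n ℕ.+ n) (2ℚ * 1/odd n) 1/suc))) null-harmonic
    where
    rearrange : ∀ K κ u → κ * κ * (2ℚ * K * u) ≡ K * κ * (κ * (2ℚ * u))
    rearrange = solve 3 (λ K κ u → κ :* κ :* (con 2ℚ :* K :* u) := K :* κ :* (κ :* (con 2ℚ :* u))) refl

  -- Partial sums of the Dirichlet eta function at 2j+3.
  etaSum : (n j : ℕ) → ℚ
  etaSum n j = ∑< n (λ i → 1/ suc i ^ (2 ℕ.* suc j ℕ.+ 1) * - sgn (suc i))

  -- The distance 2k²/(2n+1) of the weight from its sign, against 1/k³ or smaller, again leaves a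
  -- harmonic sum times 2/(2n+1).
  vanishing-weightedSum : ∀ j → Vanishing (λ n → weightedSum (n ℕ.+ n) n j - etaSum (n ℕ.+ n) j)
  vanishing-weightedSum j = null-≤ (λ n → subst
    (λ z → ∣ z ∣ ≤ harmonic (n ℕ.+ n) * (2ℚ * 1/odd n)) (difference n)
    (≤-trans
    (abs-∑< (n ℕ.+ n) (λ i _ → ≤-trans
      (abs-*-≤ {1/ suc i ^ (2 ℕ.* suc j ℕ.+ 1)} (abs-1/suc^-odd i j)
        (abs-neg-≤ {weight n (suc i) - sgn (suc i)} (abs-weight-sgn n (suc i))))
      (≤-reflexive (trans (rearrange (ι (suc i)) (1/suc i) (1/odd n))
        (trans (cong (λ z → z * z * (1/suc i * (2ℚ * 1/odd n))) (ι-suc-inverse i)) (*-identityˡ _))))))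
    (≤-reflexive (∑<-*ʳ (n ℕ.+ n) (2ℚ * 1/odd n) 1/suc)))) null-harmonic
    where
    rearrange : ∀ K κ u → κ * (κ * κ) * (2ℚ * (K * K) * u) ≡ (K * κ) * (K * κ) * (κ * (2ℚ * u))
    rearrange = solve 3 (λ K κ u → κ :* (κ :* κ) :* (con 2ℚ :* (K :* K) :* u)
                          := (K :* κ) :* (K :* κ) :* (κ :* (con 2ℚ :* u))) refl
    distribute : ∀ p v s → p * - (v - s) ≡ p * - v - p * - s
    distribute = solve 3 (λ p v s → p :* (:- (v :- s)) := p :* (:- v) :- p :* (:- s)) refl
    difference : ∀ n → ∑< (n ℕ.+ n) (λ i → 1/ suc i ^ (2 ℕ.* suc j ℕ.+ 1) * - (weight n (suc i) - sgn (suc i)))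
                     ≡ weightedSum (n ℕ.+ n) n j - etaSum (n ℕ.+ n) j
    difference n = trans
      (∑<-cong (n ℕ.+ n) (λ i → distribute (1/ suc i ^ (2 ℕ.* suc j ℕ.+ 1)) (weight n (suc i)) (sgn (suc i))))
      (∑<-minus (n ℕ.+ n) _ _)

  -- From alternating sums to zeta sums.

  sgn-double : ∀ n → sgn (n ℕ.+ n) ≡ 1ℚ
  sgn-double zero    = refl
  sgn-double (suc n) = trans (cong (λ m → - sgn m) (ℕ.+-suc n n)) (cong (λ s → - - s) (sgn-double n))

  1/suc-double : ∀ n → 1/suc (suc (n ℕ.+ n)) ≡ 1/suc 1 * 1/suc n
  1/suc-double n = trans (1/suc≡ (suc (n ℕ.+ n))) (trans (1/-cong eq)
    (trans (sym (frac* 1 2 1 (suc n))) (cong₂ _*_ (sym (1/suc≡ 1)) (sym (1/suc≡ n)))))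
    where
    eq : suc (suc (n ℕ.+ n)) ≡ 2 ℕ.* suc n
    eq = cong suc (trans (sym (ℕ.+-suc n n)) (cong (λ m → n ℕ.+ suc m) (sym (ℕ.+-identityʳ n))))

  1/suc^-double : ∀ n s → 1/ suc (suc (n ℕ.+ n)) ^ s ≡ 1/ 2 ^ s * 1/ suc n ^ s
  1/suc^-double n zero    = refl
  1/suc^-double n (suc s) = begin
    1/ suc (suc (n ℕ.+ n)) ^ suc s
      ≡⟨ 1/suc^-suc (suc (n ℕ.+ n)) s ⟩
    1/suc (suc (n ℕ.+ n)) * 1/ suc (suc (n ℕ.+ n)) ^ s
      ≡⟨ cong₂ _*_ (1/suc-double n) (1/suc^-double n s) ⟩
    1/suc 1 * 1/suc n * (1/ 2 ^ s * 1/ suc n ^ s)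
      ≡⟨ interchange (1/suc 1) (1/suc n) (1/ 2 ^ s) (1/ suc n ^ s) ⟩
    1/suc 1 * 1/ 2 ^ s * (1/suc n * 1/ suc n ^ s)
      ≡⟨ cong₂ _*_ (sym (1/suc^-suc 1 s)) (sym (1/suc^-suc n s)) ⟩
    1/ 2 ^ suc s * 1/ suc n ^ suc s ∎
    where
    open ≡-Reasoning
    interchange : ∀ a b c d → a * b * (c * d) ≡ a * c * (b * d)
    interchange = solve 4 (λ a b c d → a :* b :* (c :* d) := a :* c :* (b :* d)) refl

  -- Up to 2n, the alternating sum is the full sum minus twice its even terms; with s = 2j+3 these
  -- contribute 2 · 2^(-s) times the full sum up to n.
  etaSum-double : ∀ j n → etaSum (n ℕ.+ n) j ≡ zetaSum (n ℕ.+ n) j - 1/ 2 ^ (2 ℕ.* suc j) * zetaSum n j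
  etaSum-double j zero = refl-zero (1/ 2 ^ (2 ℕ.* suc j))
    where
    refl-zero : ∀ p → 0ℚ ≡ 0ℚ - p * 0ℚ
    refl-zero = solve 1 (λ p → con 0ℚ := con 0ℚ :- p :* con 0ℚ) refl
  etaSum-double j (suc n) = subst
    (λ m → etaSum (suc m) j ≡ zetaSum (suc m) j - p * zetaSum (suc n) j) (sym (ℕ.+-suc n n)) (begin
    etaSum m j + a * - - sgn m + b * - - - sgn m
      ≡⟨ cong₂ (λ e s → e + a * - - s + b * - - - s) (etaSum-double j n) (sgn-double n) ⟩
    zetaSum m j - p * zetaSum n j + a * - - 1ℚ + b * - - - 1ℚ
      ≡⟨ cong (λ z → zetaSum m j - p * zetaSum n j + a * - - 1ℚ + z * - - - 1ℚ) b≡ ⟩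
    zetaSum m j - p * zetaSum n j + a * - - 1ℚ + ½ * p * c * - - - 1ℚ
      ≡⟨ rearrange (zetaSum m j) p (zetaSum n j) a c ⟩
    zetaSum m j + a + ½ * p * c - p * (zetaSum n j + c)
      ≡⟨ cong (λ z → zetaSum m j + a + z - p * (zetaSum n j + c)) (sym b≡) ⟩
    zetaSum m j + a + b - p * (zetaSum n j + c) ∎)
    where
    open ≡-Reasoning
    m = n ℕ.+ n
    s = 2 ℕ.* suc j ℕ.+ 1
    p = 1/ 2 ^ (2 ℕ.* suc j)
    a = 1/ suc m ^ s
    b = 1/ suc (suc m) ^ s
    c = 1/ suc n ^ s
    b≡ : b ≡ ½ * p * c
    b≡ = trans (1/suc^-double n s) (cong (_* c) (trans (1/suc^-odd 1 (suc j)) (cong (_* p) (1/suc≡ 1))))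
    rearrange : ∀ z p y a c → z - p * y + a * - - 1ℚ + ½ * p * c * - - - 1ℚ ≡ z + a + ½ * p * c - p * (y + c)
    rearrange = solve 5 (λ z p y a c →
      z :- p :* y :+ a :* (con 1ℚ) :+ con ½ :* p :* c :* (con (- 1ℚ))
      := z :+ a :+ con ½ :* p :* c :- p :* (y :+ c)) refl

  zetaSum≡ζSum : ∀ n j → zetaSum n j ≡ ζSum (2 ℕ.* suc j ℕ.+ 1) n
  zetaSum≡ζSum n j = sym (∑≡∑< n (λ k → 1/ k ^ (2 ℕ.* suc j ℕ.+ 1)))

  -- Needed because the sum over k stops at 2n, while the n-th approximation of ζ stops at n.
  vanishing-zetaSum : ∀ j → Vanishing (λ n → zetaSum (n ℕ.+ n) j - zetaSum n j)
  vanishing-zetaSum j = vanishing-cong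
    (λ n → sym (cong₂ _-_ (zetaSum≡ζSum (n ℕ.+ n) j) (zetaSum≡ζSum n j)))
    (vanishing-double-difference {ζSum (2 ℕ.* suc j ℕ.+ 1)} (ζ-cauchy (2 ℕ.* suc j ℕ.+ 1) (1<2k+1 (suc j))))

  -- Matching the coefficients `d` and taking the limit.

  [-1]^≡sgn : ∀ n → [-1]^ n ≡ sgn n
  [-1]^≡sgn zero          = refl
  [-1]^≡sgn (suc zero)    = refl
  [-1]^≡sgn (suc (suc n)) = trans (cong (_/ 1) (trans (ℤ.-1*i≡-i _)
    (trans (cong ℤ.-_ (ℤ.-1*i≡-i (-1ℤ ℤ.^ n))) (ℤ.neg-involutive (-1ℤ ℤ.^ n)))))
    (trans ([-1]^≡sgn n) (sym (neg-involutive (sgn n))))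

  ι-double : ∀ n → ι (2 ℕ.* n) ≡ 2ℚ * ι n
  ι-double n = trans (ι-* 2 n) (cong (_* ι n) (ι≡ 2))

  suc-C : ∀ n → suc n C n ≡ suc n
  suc-C n = trans (nCk≡nC[n∸k] (ℕ.n≤1+n n))
    (trans (cong (suc n C_) (ℕ.m+n∸n≡m 1 n)) (nC1≡n (suc n)))

  -- Both sides vanish unless j = r.
  binomial-elem : ∀ r j n → j ℕ.≤ r →
    ι ((2 ℕ.* suc j) C (2 ℕ.* r ℕ.+ 1)) * elem (r ℕ.∸ j) n ≡ 2ℚ * (ι (suc j) * elem (r ℕ.∸ j) 0)
  binomial-elem r j n j≤r with ℕ.m≤n⇒m<n∨m≡n j≤r
  ... | inj₂ refl rewrite ℕ.n∸n≡0 j = trans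
    (cong (_* 1ℚ) (trans (cong ι 2j+2C2j+1) (ι-double (suc j)))) (*-assoc 2ℚ (ι (suc j)) 1ℚ)
    where
    2j+2C2j+1 : (2 ℕ.* suc j) C (2 ℕ.* j ℕ.+ 1) ≡ 2 ℕ.* suc j
    2j+2C2j+1 = trans (cong₂ _C_ (ℕ.*-suc 2 j) (ℕ.+-comm (2 ℕ.* j) 1))
      (trans (suc-C (suc (2 ℕ.* j))) (sym (ℕ.*-suc 2 j)))
  ... | inj₁ j<r with ℕ.m≤n⇒∃[o]m+o≡n j<r
  ...   | o , refl = trans
    (cong₂ (λ c k → ι c * elem k n) (k>n⇒nCk≡0 2j+2<2r+1) r∸j≡)
    (trans (trans (cong (_* elem (suc o) n) ι-zero) (*-zeroˡ (elem (suc o) n)))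
      (sym (trans (cong (λ k → 2ℚ * (ι (suc j) * elem k 0)) r∸j≡)
        (trans (cong (λ e → 2ℚ * (ι (suc j) * e)) (elem-∑< o 0))
          (trans (cong (2ℚ *_) (*-zeroʳ (ι (suc j)))) (*-zeroʳ 2ℚ))))))
    where
    r∸j≡ : suc j ℕ.+ o ℕ.∸ j ≡ suc o
    r∸j≡ = trans (cong (ℕ._∸ j) (sym (ℕ.+-suc j o))) (ℕ.m+n∸m≡n j (suc o))
    2j+2<2r+1 : 2 ℕ.* suc j ℕ.< 2 ℕ.* (suc j ℕ.+ o) ℕ.+ 1
    2j+2<2r+1 = subst (2 ℕ.* suc j ℕ.<_) (ℕ.+-comm 1 _)
      (ℕ.s≤s (ℕ.*-monoʳ-≤ 2 (ℕ.m≤m+n (suc j) o)))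

  zetaTerm : (r n j : ℕ) → ℚ
  zetaTerm r n j = ([-1]^ (suc j ℕ.+ 1)) * d r (suc j) * 1/ 2 ^ (2 ℕ.* suc j)
    * ζSum (2 ℕ.* suc j ℕ.+ 1) n * elem (r ℕ.∸ j) n

  -- The difference splits into X, the log-weighted sum; Y, the cost of replacing weights by their
  -- limiting signs; and Z, the cost of moving the zeta cutoff from 2n to n. Each is a Cauchy
  -- sequence times a vanishing one.
  vanishing-coefficient : ∀ r j → j ℕ.≤ r →
    Vanishing (λ n → signed¼ j * coefficient r (n ℕ.+ n) n j - zetaTerm r n j)
  vanishing-coefficient r j j≤r = vanishing-cong (λ n → sym (split n))
    (vanishing-*-cauchy {λ _ → signed¼ j} {λ n → X n + Y n + Z n} (cauchy-const (signed¼ j))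
      (vanishing-+ {λ n → X n + Y n} {Z} (vanishing-+ {X} {Y}
        (vanishing-*-cauchy {λ n → 2ℚ * e n} (cauchy-scale 2ℚ {e} ce) (vanishing-weightedLogSum j))
        (vanishing-*-cauchy {A} cA (vanishing-weightedSum j)))
        (vanishing-*-cauchy {λ n → A n + B} (cauchy-+ {A} {λ _ → B} cA (cauchy-const B)) (vanishing-zetaSum j))))
    where
    k = ι (suc j)
    p = 1/ 2 ^ (2 ℕ.* suc j)
    e : ℕ → ℚ
    e = elem (r ℕ.∸ j)
    B = 2ℚ * (k * elem (r ℕ.∸ j) 0)
    A X Y Z : ℕ → ℚ
    A n = 2ℚ * (k * e n)
    X n = 2ℚ * e n * weightedLogSum (n ℕ.+ n) n j
    Y n = A n * (weightedSum (n ℕ.+ n) n j - etaSum (n ℕ.+ n) j)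
    Z n = (A n + B) * (zetaSum (n ℕ.+ n) j - zetaSum n j)
    ce : Cauchy e
    ce = elem-cauchy (r ℕ.∸ j)
    cauchy-scale : ∀ c {x} → Cauchy x → Cauchy (λ n → c * x n)
    cauchy-scale c {x} cx = cauchy-* {λ _ → c} {x} (cauchy-const c) cx
    cA : Cauchy A
    cA = cauchy-scale 2ℚ {λ n → k * e n} (cauchy-scale k {e} ce)
    C₂ = (2 ℕ.* suc j) C (2 ℕ.* r ℕ.+ 1)
    -- The binomial part of `d` reproduces B, which comes from the starting value of the remainder;
    -- the other part is A times the factor 1 - 2^(-2k) relating eta to zeta.
    d*e : ∀ n → d r (suc j) * e n ≡ B + (1ℚ - p) * A n
    d*e n = trans (cong (λ z → z * e n)
        (cong₂ (λ c m → c + (1ℚ - p) * m) (sym (ι≡ C₂)) (trans (sym (ι≡ (2 ℕ.* suc j))) (ι-double (suc j)))))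
      (trans (expand (ι C₂) (1ℚ - p) k (e n)) (cong (_+ (1ℚ - p) * A n) (binomial-elem r j n j≤r)))
      where
      expand : ∀ c q k e → (c + q * (2ℚ * k)) * e ≡ c * e + q * (2ℚ * (k * e))
      expand = solve 4 (λ c q k e → (c :+ q :* (con 2ℚ :* k)) :* e
                                 := c :* e :+ q :* (con 2ℚ :* (k :* e))) refl
    zetaTerm≡ : ∀ n → zetaTerm r n j ≡ signed¼ j * ((B + (1ℚ - p) * A n) * zetaSum n j)
    zetaTerm≡ n = trans
      (cong₂ (λ s z → s * d r (suc j) * p * z * e n)
        (trans (trans (cong [-1]^_ (ℕ.+-comm (suc j) 1)) ([-1]^≡sgn (suc (suc j)))) (neg-involutive (sgn j)))
        (sym (zetaSum≡ζSum n j)))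
      (trans (regroup (sgn j) (d r (suc j)) p (zetaSum n j) (e n))
        (cong (λ z → signed¼ j * (z * zetaSum n j)) (d*e n)))
      where
      regroup : ∀ s d p z e → s * d * p * z * e ≡ s * p * (d * e * z)
      regroup = solve 5 (λ s d p z e → s :* d :* p :* z :* e := s :* p :* (d :* e :* z)) refl
    identity : ∀ t x a b v z₂ z p →
      t * (x + a * v + b * z₂) - t * ((b + (1ℚ - p) * a) * z)
      ≡ t * (x + a * (v - (z₂ - p * z)) + (a + b) * (z₂ - z))
    identity = solve 8 (λ t x a b v z₂ z p →
      t :* (x :+ a :* v :+ b :* z₂) :- t :* ((b :+ (con 1ℚ :- p) :* a) :* z)
      := t :* (x :+ a :* (v :- (z₂ :- p :* z)) :+ (a :+ b) :* (z₂ :- z))) refl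
    split : ∀ n → signed¼ j * coefficient r (n ℕ.+ n) n j - zetaTerm r n j
      ≡ signed¼ j * (X n + Y n + Z n)
    split n = trans (cong (λ z → signed¼ j * coefficient r (n ℕ.+ n) n j - z) (zetaTerm≡ n))
      (trans (identity (signed¼ j) (X n) (A n) B (weightedSum (n ℕ.+ n) n j)
                (zetaSum (n ℕ.+ n) j) (zetaSum n j) p)
        (cong (λ z → signed¼ j * (X n + A n * (weightedSum (n ℕ.+ n) n j - z) + Z n))
          (sym (etaSum-double j n))))

  vanishing-difference : ∀ r → Vanishing (λ n → tSum (twos r ∷ʳ 3) n - ∑< (suc r) (zetaTerm r n))
  vanishing-difference r = vanishing-cong (λ n → sym (split n))
    (vanishing-+ {λ n → tailSum r (n ℕ.+ n) n}
      {λ n → ∑< (suc r) (λ j → signed¼ j * coefficient r (n ℕ.+ n) n j - zetaTerm r n j)} (vanishing-tailSum r)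
      (vanishing-∑< (suc r) (λ j j≤r → vanishing-coefficient r j (ℕ.≤-pred j≤r))))
    where
    split : ∀ n → tSum (twos r ∷ʳ 3) n - ∑< (suc r) (zetaTerm r n)
      ≡ tailSum r (n ℕ.+ n) n + ∑< (suc r) (λ j → signed¼ j * coefficient r (n ℕ.+ n) n j - zetaTerm r n j)
    -- The sum over k is cut at 2n: `abs-tail` needs a cutoff well above n, and `etaSum-double` an
    -- even one.
    split n = trans (cong (_- ∑< (suc r) (zetaTerm r n)) (tSum-twos-3 r (n ℕ.+ n) n))
      (trans (+-assoc (tailSum r (n ℕ.+ n) n) (∑< (suc r) (λ j → signed¼ j * coefficient r (n ℕ.+ n) n j)) _)
        (cong (λ z → tailSum r (n ℕ.+ n) n + z) (sym (∑<-minus (suc r) _ (zetaTerm r n)))))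

  -- Translation to real numbers.

  seq-∑ᴿ : ∀ m (F : (k : ℕ) → .{{ℕ.NonZero k}} → ℝ) n → seq (∑ᴿ m F) n ≡ ∑< m (λ i → seq (F (suc i)) n)
  seq-∑ᴿ zero    F n = refl
  seq-∑ᴿ (suc m) F n = cong (_+ seq (F (suc m)) n) (seq-∑ᴿ m F n)

  -- `r + 1` does not reduce to `suc r`; with a variable m in its place the equation can be matched,
  -- after which the truncated subtractions agree.
  zetaTerm-sum : ∀ {r m} n → m ≡ suc r →
    ∑< m (λ i → ([-1]^ (suc i ℕ.+ 1)) * d r (suc i) * 1/ 2 ^ (2 ℕ.* suc i)
                  * ζSum (2 ℕ.* suc i ℕ.+ 1) n * tSum (twos (m ℕ.∸ suc i)) n)
    ≡ ∑< (suc r) (zetaTerm r n)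
  zetaTerm-sum n refl = refl

open import Data.Nat.Base using (ℕ; _+_; _*_; _∸_)
open import Data.List.Base using (_∷ʳ_)
open import Data.Rational.Base as ℚ using ()
open import Data.Nat.Properties using (+-comm)
open import Relation.Binary.PropositionalEquality using (sym; trans; cong)
open TruncatedSums using (vanishing-cong; vanishing-difference; seq-∑ᴿ; zetaTerm-sum)

theorem3p3 : (r : ℕ) →
    t (twos r ∷ʳ 3) (twos-3-admissible r)
      ≃
    ∑ᴿ (r + 1) (λ k →
      fromℚ (([-1]^ (k + 1)) ℚ.* d r k ℚ.* (1/ 2 ^ (2 * k)))
        *ᴿ ζ (2 * k + 1) (1<2k+1 k)
        *ᴿ t (twos (r + 1 ∸ k)) (twos-admissible (r + 1 ∸ k)))
-- `≃` unfolds to `Vanishing` of the difference of the approximating sequences.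
theorem3p3 r = vanishing-cong
  (λ n → cong (λ z → tSum (twos r ∷ʳ 3) n ℚ.- z)
    (sym (trans (seq-∑ᴿ (r + 1) _ n) (zetaTerm-sum n (+-comm r 1)))))
  (vanishing-difference r)
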